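{- For each computable ordinal $\alpha$ (i.e. $\alpha<\omega_1^{CK}$) there is an automatic structure whose Scott rank is at least $\alpha$.
   Context: Automatic structures: for a finite alphabet $\Sigma$ and padding symbol $\diamond\notin\Sigma$, the convolution of $(w_1,\dots,w_n)\in(\Sigma^\star)^n$ is the word of length $\max_i|w_i|$ over $(\Sigma\cup\{\diamond\})^n$ whose $k$-th letter is $(\sigma_1,\dots,\sigma_n)$, with $\sigma_i$ the $k$-th letter of $w_i$ if $k\le|w_i|$ and $\diamond$ otherwise; a relation is regular if its set of convolutions is accepted by a finite automaton; a structure in a finite relational vocabulary is automatic if (it is isomorphic to one whose) domain is a regular subset of $\Sigma^\star$ and all relations are regular. Scott rank: for tuples $\bar a,\bar b$ of equal length in a structure $\mathcal A$, $\bar a\equiv^0\bar b$ if they satisfy the same quantifier-free formulas; for $\alpha>0$, $\bar a\equiv^\alpha\bar b$ if for every $\beta<\alpha$, for every tuple $\bar c$ there is $\bar d$ with $\bar a\bar c\equiv^\beta\bar b\bar d$, and for every $\bar d$ there is $\bar c$ with $\bar a\bar c\equiv^\beta\bar b\bar d$. The Scott rank of $\bar a$ is the least $\beta$ such that for all $\bar b$, $\bar a\equiv^\beta\bar b$ implies $(\mathcal A,\bar a)\cong(\mathcal A,\bar b)$. The Scott rank of $\mathcal A$ is the least ordinal greater than the Scott ranks of all tuples of $\mathcal A$. -}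

module Defs where

open import Data.Nat using (ℕ; zero; suc; _⊔_)
open import Data.Fin using (Fin)
open import Data.Bool using (Bool; true; false; _∧_; _∨_)
open import Data.Maybe using (Maybe; just; nothing)
open import Data.List using (List; []; _∷_; length)
open import Data.Vec using (Vec; []; _∷_; lookup; _++_)
import Data.Vec as V
open import Data.Product using (Σ; _×_; _,_; ∃)
open import Data.Empty using (⊥)
open import Relation.Nullary using (¬_)
open import Relation.Binary.PropositionalEquality using (_≡_)
open import Induction.WellFounded using (Acc; acc; WellFounded)

data PR : ℕ → Set where
  zeroF : ∀ {n} → PR n
  succF : PR 1
  projF : ∀ {n} → Fin n → PR n
  compF : ∀ {m n} → PR m → Vec (PR n) m → PR n
  precF : ∀ {n} → PR n → PR (suc (suc n)) → PR (suc n)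
  muF   : ∀ {n} → PR (suc n) → PR n

mutual
  data Eval : ∀ {n} → PR n → Vec ℕ n → ℕ → Set where
    evZero : ∀ {n} {xs : Vec ℕ n} → Eval zeroF xs 0
    evSucc : ∀ {x} → Eval succF (x ∷ []) (suc x)
    evProj : ∀ {n} {i : Fin n} {xs} → Eval (projF i) xs (lookup xs i)
    evComp : ∀ {m n} {g : PR m} {hs : Vec (PR n) m} {xs ys v} →
             EvalAll hs xs ys → Eval g ys v → Eval (compF g hs) xs v
    evPrec0 : ∀ {n} {g : PR n} {h} {xs v} →
              Eval g xs v → Eval (precF g h) (0 ∷ xs) v
    evPrecS : ∀ {n} {g : PR n} {h} {y xs u v} →
              Eval (precF g h) (y ∷ xs) u → Eval h (y ∷ u ∷ xs) v →
              Eval (precF g h) (suc y ∷ xs) v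
    evMu : ∀ {n} {f : PR (suc n)} {xs v} → MuFrom f xs 0 v → Eval (muF f) xs v

  data EvalAll {n : ℕ} : ∀ {m} → Vec (PR n) m → Vec ℕ n → Vec ℕ m → Set where
    []  : ∀ {xs} → EvalAll [] xs []
    _∷_ : ∀ {m} {h : PR n} {hs : Vec (PR n) m} {xs v vs} →
          Eval h xs v → EvalAll hs xs vs → EvalAll (h ∷ hs) xs (v ∷ vs)

  data MuFrom {n : ℕ} (f : PR (suc n)) (xs : Vec ℕ n) : ℕ → ℕ → Set where
    muHere : ∀ {y} → Eval f (y ∷ xs) 0 → MuFrom f xs y y
    muNext : ∀ {y w v} → Eval f (y ∷ xs) (suc w) → MuFrom f xs (suc y) v →
             MuFrom f xs y v

Total2 : PR 2 → Set
Total2 c = ∀ x y → ∃ λ v → Eval c (x ∷ y ∷ []) v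

RelOf : PR 2 → ℕ → ℕ → Set
RelOf c x y = Eval c (x ∷ y ∷ []) 1

record DFA (Γ : Set) : Set where
  field
    nStates : ℕ
    start   : Fin nStates
    step    : Fin nStates → Γ → Fin nStates
    final   : Fin nStates → Bool

run : ∀ {Γ} (M : DFA Γ) → Fin (DFA.nStates M) → List Γ → Fin (DFA.nStates M)
run M q []       = q
run M q (x ∷ xs) = run M (DFA.step M q x) xs

Accepts : ∀ {Γ} → DFA Γ → List Γ → Set
Accepts M w = DFA.final M (run M (DFA.start M) w) ≡ true

maxLen : ∀ {A : Set} {n} → Vec (List A) n → ℕ
maxLen []       = 0
maxLen (w ∷ ws) = length w ⊔ maxLen ws

headP : ∀ {A : Set} → List A → Maybe A        -- nothing = padding symbol ◇
headP []      = nothing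
headP (x ∷ _) = just x

tailP : ∀ {A : Set} → List A → List A
tailP []       = []
tailP (_ ∷ xs) = xs

convAux : ∀ {A : Set} {n} → ℕ → Vec (List A) n → List (Vec (Maybe A) n)
convAux zero    ws = []
convAux (suc l) ws = V.map headP ws ∷ convAux l (V.map tailP ws)

conv : ∀ {A : Set} {n} → Vec (List A) n → List (Vec (Maybe A) n)
conv ws = convAux (maxLen ws) ws

record AutoStruct : Set where
  field
    k      : ℕ
    s      : ℕ
    arity  : Fin s → ℕ
    domA   : DFA (Fin k)
    relA   : (i : Fin s) → DFA (Vec (Maybe (Fin k)) (arity i))

module _ (A : AutoStruct) where
  open AutoStruct A

  record Dom : Set where
    constructor el
    field
      word : List (Fin k)
      inL  : Accepts domA word
  open Dom public

  Holds : (i : Fin s) → Vec Dom (arity i) → Set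
  Holds i t = Accepts (relA i) (conv (V.map word t))

  data QF (m : ℕ) : Set where
    eqF  : Fin m → Fin m → QF m
    relF : (i : Fin s) → Vec (Fin m) (arity i) → QF m
    notF : QF m → QF m
    andF : QF m → QF m → QF m

  Sat : ∀ {m} → QF m → Vec Dom m → Set
  Sat (eqF x y)   a = word (lookup a x) ≡ word (lookup a y)
  Sat (relF i xs) a = Holds i (V.map (lookup a) xs)
  Sat (notF φ)    a = ¬ Sat φ a
  Sat (andF φ ψ)  a = Sat φ a × Sat ψ a

  QFEquiv : ∀ {m} → Vec Dom m → Vec Dom m → Set
  QFEquiv a b = ∀ φ → (Sat φ a → Sat φ b) × (Sat φ b → Sat φ a)

  Iso : ∀ {m} → Vec Dom m → Vec Dom m → Set
  Iso {m} a b =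
    Σ (Dom → Dom) λ f → Σ (Dom → Dom) λ g →
      (∀ x → word (g (f x)) ≡ word x) ×
      (∀ y → word (f (g y)) ≡ word y) ×
      (∀ i (t : Vec Dom (arity i)) →
         (Holds i t → Holds i (V.map f t)) × (Holds i (V.map f t) → Holds i t)) ×
      (∀ (j : Fin m) → word (f (lookup a j)) ≡ word (lookup b j))

  -- Back-and-forth relation ≡^{rank(n)} where rank is the rank function of
  -- a well-founded relation R on ℕ (defined by recursion on accessibility).
  BF : (R : ℕ → ℕ → Set) (n : ℕ) → Acc R n → ∀ {m} → Vec Dom m → Vec Dom m → Set
  BF R n (acc rs) a b =
    QFEquiv a b ×
    (∀ {j} (r : R j n) → ∀ l (c : Vec Dom l) → ∃ λ d → BF R j (rs r) (a ++ c) (b ++ d)) ×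
    (∀ {j} (r : R j n) → ∀ l (d : Vec Dom l) → ∃ λ c → BF R j (rs r) (a ++ c) (b ++ d))

  -- Scott rank of A is ≥ the height  sup { rank(n) + 1 : n ∈ ℕ }  of the
  -- well-founded relation R: for every n, some tuple ā has Scott rank ≥ rank(n),
  -- i.e. for every j R n, ≡^{rank(j)} does not suffice for ā to determine its orbit.
  ScottRankAtLeastHeight : (R : ℕ → ℕ → Set) → WellFounded R → Set
  ScottRankAtLeastHeight R wf =
    ∀ n → Σ ℕ λ m → Σ (Vec Dom m) λ a →
      ∀ {j} → R j n → ¬ (∀ (b : Vec Dom m) → BF R j (wf j) a b → Iso a b)

{-# OPTIONS --safe #-}

-- Fix a machine with finitely many registers that, holding a point n, guesses a padding t and a
-- point j, checks c(j, n) = 1 (rejecting otherwise), and starts again from j.  It records all visited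
-- control states, so each configuration has a unique predecessor, and one step changes each track of
-- a configuration (history stack, unary registers) locally, hence is recognised by an automaton.
-- An element of the structure is a configuration w together with a finite set h of naturals.  The
-- relations make w rigid and relate (w, h) to a successor (w', h') as follows: the parities of h and
-- h' agree; if w guesses, the guessed number y lies in h iff h' is odd; if w rejects, h is even.
--
-- An automorphism acts on the sets h over each w.  By well-founded induction it preserves parities
-- over every configuration reachable from a start: a parity change over w forces one over some
-- successor, and rejecting configurations forbid it.  On the other hand, symmetric difference with
-- the singleton of the choice taken at each configuration on a path from the start to an end e
-- respects all relations among tuples that contain no element over e.  If e is about to guess from
-- the point n, then the path can be continued, for each j R n, to a configuration about to guess
-- from j which is longer than any given word, by taking t large.  Hence these maps give
-- back-and-forth systems of height rank(n), although they move the start to another orbit.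
module Submission where

open import Defs
open import Data.Nat using (ℕ; zero; suc; _+_; _*_; _⊔_; _≤_; _<_; z≤n; s≤s; _<ᵇ_; _≡ᵇ_; _<?_)
open import Data.Nat.Properties as ℕₚ using (≤-refl; ≤-trans; m≤m⊔n; m≤n⊔m; m≤n+m; m≤m+n)
open import Data.Fin using (Fin; zero; suc; toℕ; fromℕ<; combine; remQuot; join; splitAt; _↑ˡ_; _↑ʳ_)
import Data.Fin.Properties as Finₚ
open import Data.Bool using (Bool; true; false; _∧_; _∨_; not; _xor_; if_then_else_)
import Data.Bool.Properties as Boolₚ
open import Data.Maybe using (Maybe; just; nothing; is-just)
open import Data.Maybe.Properties using (just-injective)
open import Data.List using (List; []; _∷_; length; foldl)
import Data.List.Properties as Listₚ
open import Data.Vec using (Vec; []; _∷_; lookup; tabulate; _++_)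
import Data.Vec as Vec
import Data.Vec.Properties as Vecₚ
open import Data.Product using (Σ; ∃; _×_; _,_; proj₁; proj₂)
open import Data.Sum using (_⊎_; inj₁; inj₂)
open import Data.Unit using (⊤; tt)
open import Data.Empty using (⊥; ⊥-elim)
open import Function using (_∘_; id)
open import Relation.Nullary using (¬_; Dec; yes; no; does)
open import Relation.Nullary.Decidable using (map′; dec-true; _×-dec_; _→-dec_; ¬?)
open import Relation.Binary using (DecidableEquality)
open import Relation.Binary.PropositionalEquality
open import Induction.WellFounded using (Acc; acc; WellFounded)
open import Axiom.UniquenessOfIdentityProofs using (module Decidable⇒UIP)

-- Finite types and their closure under sums, products and vectors.

record Finite (A : Set) : Set where
  field
    size       : ℕ
    index      : A → Fin size
    elem       : Fin size → A
    elem-index : ∀ a → elem (index a) ≡ a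
    index-elem : ∀ i → index (elem i) ≡ i

  elem-injective : ∀ {i j} → elem i ≡ elem j → i ≡ j
  elem-injective eq = trans (sym (index-elem _)) (trans (cong index eq) (index-elem _))

  _≟F_ : DecidableEquality A
  a ≟F b = map′ (λ eq → trans (sym (elem-index a)) (trans (cong elem eq) (elem-index b)))
                (cong index) (index a Finₚ.≟ index b)


open Finite

finite-⊤ : Finite ⊤
finite-⊤ = record
  { size = 1 ; index = λ _ → zero ; elem = λ _ → tt
  ; elem-index = λ _ → refl ; index-elem = λ { zero → refl } }

finite-Fin : ∀ n → Finite (Fin n)
finite-Fin n = record
  { size = n ; index = id ; elem = id ; elem-index = λ _ → refl ; index-elem = λ _ → refl }

finite-retype : ∀ {A B} (f : A → B) (g : B → A) → (∀ b → f (g b) ≡ b) → (∀ a → g (f a) ≡ a) →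
                Finite A → Finite B
finite-retype f g fg gf F = record
  { size = size F ; index = index F ∘ g ; elem = f ∘ elem F
  ; elem-index = λ b → trans (cong f (elem-index F (g b))) (fg b)
  ; index-elem = λ i → trans (cong (index F) (gf _)) (index-elem F i) }

finite-⊎ : ∀ {A B} → Finite A → Finite B → Finite (A ⊎ B)
finite-⊎ {A} {B} F G = record
  { size = size F + size G ; index = to ; elem = from ; elem-index = from-to ; index-elem = to-from }
  where
  toS : A ⊎ B → Fin (size F) ⊎ Fin (size G)
  toS (inj₁ a) = inj₁ (index F a)
  toS (inj₂ b) = inj₂ (index G b)
  fromS : Fin (size F) ⊎ Fin (size G) → A ⊎ B
  fromS (inj₁ a) = inj₁ (elem F a)
  fromS (inj₂ b) = inj₂ (elem G b)
  fromS-toS : ∀ x → fromS (toS x) ≡ x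
  fromS-toS (inj₁ a) = cong inj₁ (elem-index F a)
  fromS-toS (inj₂ b) = cong inj₂ (elem-index G b)
  toS-fromS : ∀ x → toS (fromS x) ≡ x
  toS-fromS (inj₁ a) = cong inj₁ (index-elem F a)
  toS-fromS (inj₂ b) = cong inj₂ (index-elem G b)
  to : A ⊎ B → Fin (size F + size G)
  to x = join (size F) (size G) (toS x)
  from : Fin (size F + size G) → A ⊎ B
  from i = fromS (splitAt (size F) i)
  from-to : ∀ x → from (to x) ≡ x
  from-to x = trans (cong fromS (Finₚ.splitAt-join (size F) (size G) (toS x))) (fromS-toS x)
  to-from : ∀ i → to (from i) ≡ i
  to-from i = trans (cong (join (size F) (size G)) (toS-fromS (splitAt (size F) i)))
                    (Finₚ.join-splitAt (size F) (size G) i)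

finite-× : ∀ {A B} → Finite A → Finite B → Finite (A × B)
finite-× {A} {B} F G = record
  { size = size F * size G
  ; index = λ { (a , b) → combine (index F a) (index G b) }
  ; elem = from
  ; elem-index = λ { (a , b) → trans
      (cong (λ x → elem F (proj₁ x) , elem G (proj₂ x)) (Finₚ.remQuot-combine (index F a) (index G b)))
      (cong₂ _,_ (elem-index F a) (elem-index G b)) }
  ; index-elem = λ i → trans
      (cong₂ combine (index-elem F (proj₁ (remQuot {size F} (size G) i)))
                     (index-elem G (proj₂ (remQuot {size F} (size G) i))))
      (Finₚ.combine-remQuot {size F} (size G) i) }
  where
  from : Fin (size F * size G) → A × B
  from i = elem F (proj₁ (remQuot {size F} (size G) i)) , elem G (proj₂ (remQuot {size F} (size G) i))

finite-Bool : Finite Bool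
finite-Bool = record
  { size = 2
  ; index = λ { false → zero ; true → suc zero }
  ; elem = λ { zero → false ; (suc zero) → true }
  ; elem-index = λ { false → refl ; true → refl }
  ; index-elem = λ { zero → refl ; (suc zero) → refl } }

finite-Maybe : ∀ {A} → Finite A → Finite (Maybe A)
finite-Maybe F = finite-retype
  (λ { (inj₁ _) → nothing ; (inj₂ a) → just a }) (λ { nothing → inj₁ tt ; (just a) → inj₂ a })
  (λ { nothing → refl ; (just _) → refl }) (λ { (inj₁ _) → refl ; (inj₂ _) → refl })
  (finite-⊎ finite-⊤ F)

finite-Vec : ∀ {A} → Finite A → ∀ n → Finite (Vec A n)
finite-Vec F zero = finite-retype (λ _ → []) (λ _ → tt) (λ { [] → refl }) (λ _ → refl) finite-⊤
finite-Vec F (suc n) = finite-retype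
  (λ { (x , xs) → x ∷ xs }) (λ { (x ∷ xs) → x , xs }) (λ { (_ ∷ _) → refl }) (λ _ → refl)
  (finite-× F (finite-Vec F n))

-- Automata with an arbitrary finite type of states.

record Automaton (Γ : Set) : Set₁ where
  field
    State   : Set
    finite  : Finite State
    initial : State
    next    : State → Γ → State
    accept  : State → Bool

toDFA : ∀ {Γ} → Automaton Γ → DFA Γ
toDFA A = record
  { nStates = size finite
  ; start = index finite initial
  ; step = λ q x → index finite (next (elem finite q) x)
  ; final = λ q → accept (elem finite q) }
  where open Automaton A

module _ {Γ : Set} (A : Automaton Γ) where
  open Automaton A

  run-toDFA : ∀ q w → elem finite (run (toDFA A) (index finite q) w) ≡ foldl next q w
  run-toDFA q []      = elem-index finite q
  run-toDFA q (x ∷ w) = trans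
    (cong (λ q′ → elem finite (run (toDFA A) (index finite (next q′ x)) w)) (elem-index finite q))
    (run-toDFA (next q x) w)

  accepts-toDFA : ∀ w → DFA.final (toDFA A) (run (toDFA A) (DFA.start (toDFA A)) w) ≡
                        accept (foldl next initial w)
  accepts-toDFA w = cong accept (run-toDFA initial w)

_∧A_ : ∀ {Γ} → Automaton Γ → Automaton Γ → Automaton Γ
A ∧A B = record
  { State = A.State × B.State
  ; finite = finite-× A.finite B.finite
  ; initial = A.initial , B.initial
  ; next = λ { (p , q) x → A.next p x , B.next q x }
  ; accept = λ { (p , q) → A.accept p ∧ B.accept q } }
  where module A = Automaton A
        module B = Automaton B

-- Parities of Boolean sequences.

xorSum : ℕ → (ℕ → Bool) → Bool
xorSum zero    g = false
xorSum (suc n) g = g 0 xor xorSum n (g ∘ suc)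

xorSum-cong : ∀ n {g g′} → (∀ p → g p ≡ g′ p) → xorSum n g ≡ xorSum n g′
xorSum-cong zero    eq = refl
xorSum-cong (suc n) eq = cong₂ _xor_ (eq 0) (xorSum-cong n (eq ∘ suc))

xorSum-false : ∀ n {g} → (∀ p → g p ≡ false) → xorSum n g ≡ false
xorSum-false zero    eq = refl
xorSum-false (suc n) eq rewrite eq 0 = xorSum-false n (eq ∘ suc)

xorSum-stable : ∀ {m n} {g} → m ≤ n → (∀ p → m ≤ p → g p ≡ false) → xorSum n g ≡ xorSum m g
xorSum-stable {n = n} z≤n eq = xorSum-false n (λ p → eq p z≤n)
xorSum-stable {g = g} (s≤s m≤n) eq =
  cong (g 0 xor_) (xorSum-stable m≤n (λ p m≤p → eq (suc p) (s≤s m≤p)))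

xor-interchange : ∀ a b c d → (a xor b) xor (c xor d) ≡ (a xor c) xor (b xor d)
xor-interchange false false c d = refl
xor-interchange false true false d = refl
xor-interchange false true true d = refl
xor-interchange true false false d = refl
xor-interchange true false true d = Boolₚ.not-involutive d
xor-interchange true true false d = sym (Boolₚ.not-involutive d)
xor-interchange true true true d = refl

xorSum-xor : ∀ n g g′ → xorSum n (λ p → g p xor g′ p) ≡ xorSum n g xor xorSum n g′
xorSum-xor zero    g g′ = refl
xorSum-xor (suc n) g g′ = trans (cong ((g 0 xor g′ 0) xor_) (xorSum-xor n (g ∘ suc) (g′ ∘ suc)))
                                (xor-interchange (g 0) (g′ 0) _ _)

xorSum-single : ∀ {n y} → y < n → (g : ℕ → Bool) → xorSum n (λ p → (p ≡ᵇ y) ∧ g p) ≡ g y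
xorSum-single {suc n} {zero} _ g = trans (cong (g 0 xor_) (xorSum-false n (λ _ → refl)))
                                         (Boolₚ.xor-identityʳ (g 0))
xorSum-single {suc n} {suc y} (s≤s y<n) g = xorSum-single y<n (g ∘ suc)

from-does : ∀ {P : Set} (P? : Dec P) → does P? ≡ true → P
from-does (yes p) _ = p

-- Words as streams of letters that are eventually blank.

module Words {L : Set} (finL : Finite L) (blank : L) where

  Word : Set
  Word = List (Fin (size finL))

  at : Word → ℕ → L
  at []      _       = blank
  at (x ∷ v) zero    = elem finL x
  at (x ∷ v) (suc p) = at v p

  at-beyond : ∀ v {p} → length v ≤ p → at v p ≡ blank
  at-beyond []      _         = refl
  at-beyond (x ∷ v) (s≤s len) = at-beyond v len

  nonBlank : Fin (size finL) → Bool
  nonBlank x = not (does (_≟F_ finL (elem finL x) blank))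

  isBlank : ∀ x → nonBlank x ≡ false → elem finL x ≡ blank
  isBlank x eq = from-does (_≟F_ finL (elem finL x) blank) (Boolₚ.not-injective eq)

  -- The state tells whether the last letter read is not blank. Words without a trailing blank form
  -- the domain, so that each eventually blank stream is represented by exactly one element.
  normalA : Automaton (Fin (size finL))
  normalA = record
    { State = Bool ; finite = finite-Bool ; initial = true
    ; next = λ _ → nonBlank ; accept = id }

  normalFrom : Bool → Word → Bool
  normalFrom = foldl (λ _ → nonBlank)

  abstract
    normalDFA : DFA (Fin (size finL))
    normalDFA = toDFA normalA

    normal⇒ : ∀ v → Accepts normalDFA v → normalFrom true v ≡ true
    normal⇒ v n = trans (sym (accepts-toDFA normalA v)) n

    ⇒normal : ∀ v → normalFrom true v ≡ true → Accepts normalDFA v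
    ⇒normal v n = trans (accepts-toDFA normalA v) n

  Normal : Word → Set
  Normal v = Accepts normalDFA v

  normal-tail : ∀ x v → Normal (x ∷ v) → Normal v
  normal-tail x []      _ = ⇒normal [] refl
  normal-tail x (y ∷ v) n = ⇒normal (y ∷ v) (normal⇒ (x ∷ y ∷ v) n)

  normal-nonzero : ∀ x v → Normal (x ∷ v) → ¬ (∀ p → at (x ∷ v) p ≡ blank)
  normal-nonzero x [] n z with normal⇒ (x ∷ []) n
  ... | eq rewrite dec-true (_≟F_ finL (elem finL x) blank) (z 0) with () ← eq
  normal-nonzero x (y ∷ v) n z = normal-nonzero y v (normal-tail x (y ∷ v) n) (z ∘ suc)

  -- If one word ends first, the rest of the other is blank throughout, which `normal-nonzero`
  -- excludes.
  normal-ext : ∀ u v → Normal u → Normal v → (∀ p → at u p ≡ at v p) → u ≡ v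
  normal-ext []      []      _  _  _  = refl
  normal-ext []      (y ∷ v) _  nv eq = ⊥-elim (normal-nonzero y v nv (sym ∘ eq))
  normal-ext (x ∷ u) []      nu _  eq = ⊥-elim (normal-nonzero x u nu eq)
  normal-ext (x ∷ u) (y ∷ v) nu nv eq =
    cong₂ _∷_ (elem-injective finL (eq 0))
              (normal-ext u v (normal-tail x u nu) (normal-tail y v nv) (eq ∘ suc))

  -- A blank put in front of the empty word would be a trailing blank, so it is dropped.
  consTrim : Fin (size finL) → Word → Word
  consTrim x []      = if nonBlank x then x ∷ [] else []
  consTrim x (y ∷ v) = x ∷ y ∷ v

  consTrim-zero : ∀ x v → at (consTrim x v) 0 ≡ elem finL x
  consTrim-zero x (y ∷ v) = refl
  consTrim-zero x [] with nonBlank x in eq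
  ... | true  = refl
  ... | false = sym (isBlank x eq)

  consTrim-suc : ∀ x v p → at (consTrim x v) (suc p) ≡ at v p
  consTrim-suc x (y ∷ v) p = refl
  consTrim-suc x [] p with nonBlank x
  ... | true  = refl
  ... | false = refl

  consTrim-normal : ∀ x v → Normal v → Normal (consTrim x v)
  consTrim-normal x (y ∷ v) n = ⇒normal (x ∷ y ∷ v) (normal⇒ (y ∷ v) n)
  consTrim-normal x [] n with nonBlank x in eq
  ... | true  = ⇒normal (x ∷ []) eq
  ... | false = n

  consTrim-length : ∀ x v → length (consTrim x v) ≤ suc (length v)
  consTrim-length x (y ∷ v) = ≤-refl
  consTrim-length x [] with nonBlank x
  ... | true  = ≤-refl
  ... | false = z≤n

  fromStream : (ℕ → L) → ℕ → Word
  fromStream g zero    = []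
  fromStream g (suc n) = consTrim (index finL (g 0)) (fromStream (g ∘ suc) n)

  fromStream-normal : ∀ g n → Normal (fromStream g n)
  fromStream-normal g zero    = ⇒normal [] refl
  fromStream-normal g (suc n) = consTrim-normal (index finL (g 0)) (fromStream (g ∘ suc) n) (fromStream-normal (g ∘ suc) n)

  fromStream-length : ∀ g n → length (fromStream g n) ≤ n
  fromStream-length g zero    = z≤n
  fromStream-length g (suc n) = ≤-trans (consTrim-length (index finL (g 0)) (fromStream (g ∘ suc) n)) (s≤s (fromStream-length (g ∘ suc) n))

  at-fromStream : ∀ g n → (∀ p → n ≤ p → g p ≡ blank) → ∀ p → at (fromStream g n) p ≡ g p
  at-fromStream g zero    bl p       = sym (bl p z≤n)
  at-fromStream g (suc n) bl zero    = trans (consTrim-zero _ (fromStream (g ∘ suc) n)) (elem-index finL (g 0))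
  at-fromStream g (suc n) bl (suc p) = trans (consTrim-suc _ (fromStream (g ∘ suc) n) p)
    (at-fromStream (g ∘ suc) n (λ q n≤q → bl (suc q) (s≤s n≤q)) p)

  -- Padding is read as the blank letter, so an automaton on convolutions sees two streams instead
  -- of two words of different lengths.
  padded : Maybe (Fin (size finL)) → L
  padded nothing  = blank
  padded (just x) = elem finL x

  module _ (A : Automaton (L × L)) where
    open Automaton A

    runStreams : State → (ℕ → L) → (ℕ → L) → ℕ → State
    runStreams q U V zero    = q
    runStreams q U V (suc n) = runStreams (next q (U 0 , V 0)) (U ∘ suc) (V ∘ suc) n

    onPairs : Automaton (Vec (Maybe (Fin (size finL))) 2)
    onPairs = record
      { State = State ; finite = finite ; initial = initial ; accept = accept
      ; next = λ { q (x ∷ y ∷ []) → next q (padded x , padded y) } }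

    foldl-convAux : ∀ n q u v → foldl (Automaton.next onPairs) q (convAux n (u ∷ v ∷ [])) ≡
                                runStreams q (at u) (at v) n
    foldl-convAux zero    q u       v       = refl
    foldl-convAux (suc n) q []      []      = foldl-convAux n _ [] []
    foldl-convAux (suc n) q []      (y ∷ v) = foldl-convAux n _ [] v
    foldl-convAux (suc n) q (x ∷ u) []      = foldl-convAux n _ u []
    foldl-convAux (suc n) q (x ∷ u) (y ∷ v) = foldl-convAux n _ u v

    accepts-pair : ∀ u v → DFA.final (toDFA onPairs)
                     (run (toDFA onPairs) (DFA.start (toDFA onPairs)) (conv (u ∷ v ∷ []))) ≡
                   accept (runStreams initial (at u) (at v) (maxLen (u ∷ v ∷ [])))
    accepts-pair u v = trans (accepts-toDFA onPairs (conv (u ∷ v ∷ [])))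
                             (cong accept (foldl-convAux (maxLen (u ∷ v ∷ [])) initial u v))

  runStreams-∧A : ∀ A B p q U V n → runStreams (A ∧A B) (p , q) U V n ≡
                  (runStreams A p U V n , runStreams B q U V n)
  runStreams-∧A A B p q U V zero    = refl
  runStreams-∧A A B p q U V (suc n) = runStreams-∧A A B _ _ (U ∘ suc) (V ∘ suc) n

  -- Automata checking local conditions on two streams.

  module Window
    (φ₀  : L → L → Set) (φ₀? : ∀ a b → Dec (φ₀ a b))
    (φ   : L → L → L → L → Set) (φ? : ∀ a b c d → Dec (φ a b c d))
    (φ-blank : φ blank blank blank blank) where

    data Win : Set where
      start  : Win
      prev   : L → L → Win
      failed : Win

    windowNext : Win → L × L → Win
    windowNext failed     _       = failed
    windowNext start      (c , d) = if does (φ₀? c d) then prev c d else failed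
    windowNext (prev a b) (c , d) = if does (φ? a b c d) then prev c d else failed

    -- When the input ends, the streams go on with blanks. Only the window from the last pair of
    -- letters to the blanks remains to be checked, as `φ-blank` settles all later ones.
    windowAccept : Win → Bool
    windowAccept failed     = false
    windowAccept start      = does (φ₀? blank blank)
    windowAccept (prev a b) = does (φ? a b blank blank)

    windowA : Automaton (L × L)
    windowA = record
      { State = Win
      ; finite = finite-retype
          (λ { (inj₁ false) → start ; (inj₁ true) → failed ; (inj₂ (a , b)) → prev a b })
          (λ { start → inj₁ false ; failed → inj₁ true ; (prev a b) → inj₂ (a , b) })
          (λ { start → refl ; failed → refl ; (prev a b) → refl })
          (λ { (inj₁ false) → refl ; (inj₁ true) → refl ; (inj₂ _) → refl })
          (finite-⊎ finite-Bool (finite-× finL finL))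
      ; initial = start ; next = windowNext ; accept = windowAccept }

    Steps : (ℕ → L) → (ℕ → L) → Set
    Steps U V = ∀ p → φ (U p) (V p) (U (suc p)) (V (suc p))

    private
      BlankFrom : ℕ → (ℕ → L) → Set
      BlankFrom n U = ∀ p → n ≤ p → U p ≡ blank

      tailBlank : ∀ {n U} → BlankFrom (suc n) U → BlankFrom n (U ∘ suc)
      tailBlank bl p n≤p = bl (suc p) (s≤s n≤p)

      run-failed : ∀ n U V → runStreams windowA failed U V n ≡ failed
      run-failed zero    U V = refl
      run-failed (suc n) U V = run-failed n (U ∘ suc) (V ∘ suc)

      steps-blank : ∀ {U V} → BlankFrom 0 U → BlankFrom 0 V → Steps U V
      steps-blank bu bv p
        rewrite bu p z≤n | bv p z≤n | bu (suc p) z≤n | bv (suc p) z≤n = φ-blank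

      sound-prev : ∀ n a b {U V} → BlankFrom n U → BlankFrom n V →
                   windowAccept (runStreams windowA (prev a b) U V n) ≡ true →
                   φ a b (U 0) (V 0) × Steps U V
      sound-prev zero a b bu bv ok =
        subst₂ (φ a b) (sym (bu 0 z≤n)) (sym (bv 0 z≤n)) (from-does (φ? a b blank blank) ok) ,
        steps-blank bu bv
      sound-prev (suc n) a b {U} {V} bu bv ok with φ? a b (U 0) (V 0)
      ... | no _ rewrite run-failed n (U ∘ suc) (V ∘ suc) with () ← ok
      ... | yes h with sound-prev n (U 0) (V 0) (tailBlank bu) (tailBlank bv) ok
      ...   | h₁ , hs = h , λ { zero → h₁ ; (suc p) → hs p }

      complete-prev : ∀ n a b {U V} → BlankFrom n U → BlankFrom n V →
                      φ a b (U 0) (V 0) → Steps U V →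
                      windowAccept (runStreams windowA (prev a b) U V n) ≡ true
      complete-prev zero a b bu bv h hs =
        dec-true (φ? a b blank blank) (subst₂ (φ a b) (bu 0 z≤n) (bv 0 z≤n) h)
      complete-prev (suc n) a b {U} {V} bu bv h hs
        rewrite dec-true (φ? a b (U 0) (V 0)) h =
        complete-prev n (U 0) (V 0) (tailBlank bu) (tailBlank bv) (hs 0) (hs ∘ suc)

    window-sound : ∀ n {U V} → BlankFrom n U → BlankFrom n V →
                   windowAccept (runStreams windowA start U V n) ≡ true →
                   φ₀ (U 0) (V 0) × Steps U V
    window-sound zero bu bv ok =
      subst₂ φ₀ (sym (bu 0 z≤n)) (sym (bv 0 z≤n)) (from-does (φ₀? blank blank) ok) ,
      steps-blank bu bv
    window-sound (suc n) {U} {V} bu bv ok with φ₀? (U 0) (V 0)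
    ... | no _ rewrite run-failed n (U ∘ suc) (V ∘ suc) with () ← ok
    ... | yes h with sound-prev n (U 0) (V 0) (tailBlank bu) (tailBlank bv) ok
    ...   | h₁ , hs = h , λ { zero → h₁ ; (suc p) → hs p }

    window-complete : ∀ n {U V} → BlankFrom n U → BlankFrom n V →
                      φ₀ (U 0) (V 0) → Steps U V →
                      windowAccept (runStreams windowA start U V n) ≡ true
    window-complete zero bu bv h hs =
      dec-true (φ₀? blank blank) (subst₂ φ₀ (bu 0 z≤n) (bv 0 z≤n) h)
    window-complete (suc n) {U} {V} bu bv h hs
      rewrite dec-true (φ₀? (U 0) (V 0)) h =
      complete-prev n (U 0) (V 0) (tailBlank bu) (tailBlank bv) (hs 0) (hs ∘ suc)

-- Instructions of register machines, and numbers in unary notation.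

data Action (R : Set) : Set where
  inc dec guess : R → Action R
  copy : R → R → Action R
  test : R → Bool → Action R
  stop : Action R

data Instr (S R : Set) : Set where
  exec : Action R → S → Instr S R
  jump : R → S → S → Instr S R

-- A jump is split into two tests, one for each outcome b. For `exec` both values of b name the same
-- transition.
rule : ∀ {S R} → Instr S R → Bool → Action R × S
rule (exec a s)     b = a , s
rule (jump r s₀ s₁) b = test r b , (if b then s₁ else s₀)

-- A bounded, downward closed set of positions is an initial segment. This reads a guessed number
-- off its track.
unary-track : (g : ℕ → Bool) → (∀ p → g (suc p) ≡ true → g p ≡ true) →
              ∀ n → (∀ p → n ≤ p → g p ≡ false) → ∃ λ y → ∀ p → g p ≡ (p <ᵇ y)
unary-track g mono zero    bl = 0 , λ p → bl p z≤n
unary-track g mono (suc n) bl with g 0 in g0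
... | false = 0 , allFalse
  where
  allFalse : ∀ p → g p ≡ false
  allFalse zero = g0
  allFalse (suc p) with g (suc p) in eq
  ... | false = refl
  ... | true  = trans (sym (mono p eq)) (allFalse p)
... | true with unary-track (g ∘ suc) (mono ∘ suc) n (λ p n≤p → bl (suc p) (s≤s n≤p))
...   | y , eq = suc y , λ { zero → g0 ; (suc p) → eq p }

<ᵇ-injective : ∀ m n → (∀ p → (p <ᵇ m) ≡ (p <ᵇ n)) → m ≡ n
<ᵇ-injective zero    zero    eq = refl
<ᵇ-injective zero    (suc n) eq with () ← eq 0
<ᵇ-injective (suc m) zero    eq with () ← eq 0
<ᵇ-injective (suc m) (suc n) eq = cong suc (<ᵇ-injective m n (eq ∘ suc))

≤⇒≮ᵇ : ∀ {m n} → n ≤ m → (m <ᵇ n) ≡ false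
≤⇒≮ᵇ z≤n       = refl
≤⇒≮ᵇ (s≤s n≤m) = ≤⇒≮ᵇ n≤m

-- The automatic structure of a machine.

module Structure {S : Set} (finS : Finite S) (M : ℕ) (prog : S → Instr S (Fin M)) where

  -- The letter at position p holds the p-th entry of the history and, for each register, whether p
  -- is below its content. `Letter` adds whether p belongs to the finite set.
  WLetter : Set
  WLetter = Maybe S × Vec Bool M

  Letter : Set
  Letter = WLetter × Bool

  wblank : WLetter
  wblank = nothing , Vec.replicate M false

  blank : Letter
  blank = wblank , false

  abstract
    finW : Finite WLetter
    finW = finite-× (finite-Maybe finS) (finite-Vec finite-Bool M)

    finL : Finite Letter
    finL = finite-× finW finite-Bool

  open Words finL blank public

  _≟W_ : DecidableEquality WLetter
  _≟W_ = _≟F_ finW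

  _≟T_ : DecidableEquality (Maybe S)
  _≟T_ = _≟F_ (finite-Maybe finS)

  top : WLetter → Maybe S
  top = proj₁

  bit : Fin M → WLetter → Bool
  bit r a = lookup (proj₂ a) r

  bit-wblank : ∀ r → bit r wblank ≡ false
  bit-wblank r = Vecₚ.lookup-replicate r false

  bits-ext : ∀ {a c : WLetter} → top a ≡ top c → (∀ r → bit r a ≡ bit r c) → a ≡ c
  bits-ext {s , v} {_ , v′} refl eq = cong (s ,_) (trans (sym (Vecₚ.tabulate∘lookup v))
    (trans (Vecₚ.tabulate-cong eq) (Vecₚ.tabulate∘lookup v′)))

  Same : WLetter → WLetter → Set
  Same a c = ∀ i → bit i c ≡ bit i a

  SameExcept : Fin M → WLetter → WLetter → Set
  SameExcept r a c = ∀ i → i ≢ r → bit i c ≡ bit i a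

  -- Start constrains the first letters of a step, Local every window of two consecutive letters.
  -- A unary register grows and shrinks at the front of its track, which shifts the track by one.
  Start : Action (Fin M) → WLetter → WLetter → Set
  Start (inc r)    a c = bit r c ≡ true
  Start (dec r)    a c = bit r a ≡ true
  Start (test r b) a c = bit r a ≡ b
  Start (copy _ _) a c = ⊤
  Start (guess _)  a c = ⊤
  Start stop       a c = ⊤

  Local : Action (Fin M) → WLetter → WLetter → WLetter → WLetter → Set
  Local (inc r)     a c a′ c′ = SameExcept r a c × bit r c′ ≡ bit r a
  Local (dec r)     a c a′ c′ = SameExcept r a c × bit r a′ ≡ bit r c
  Local (guess r)   a c a′ c′ = SameExcept r a c × bit r a ≡ false × (bit r c′ ≡ true → bit r c ≡ true)
  Local (copy r r′) a c a′ c′ = SameExcept r′ a c × bit r′ a ≡ false × bit r′ c ≡ bit r a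
  Local (test _ _)  a c a′ c′ = Same a c
  Local stop        a c a′ c′ = Same a c

  same? : ∀ a c → Dec (Same a c)
  same? a c = Finₚ.all? (λ i → bit i c Boolₚ.≟ bit i a)

  sameExcept? : ∀ r a c → Dec (SameExcept r a c)
  sameExcept? r a c = Finₚ.all? (λ i → ¬? (i Finₚ.≟ r) →-dec (bit i c Boolₚ.≟ bit i a))

  start? : ∀ act a c → Dec (Start act a c)
  start? (inc r)    a c = bit r c Boolₚ.≟ true
  start? (dec r)    a c = bit r a Boolₚ.≟ true
  start? (test r b) a c = bit r a Boolₚ.≟ b
  start? (copy _ _) a c = yes tt
  start? (guess _)  a c = yes tt
  start? stop       a c = yes tt

  local? : ∀ act a c a′ c′ → Dec (Local act a c a′ c′)
  local? (inc r)     a c a′ c′ = sameExcept? r a c ×-dec (bit r c′ Boolₚ.≟ bit r a)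
  local? (dec r)     a c a′ c′ = sameExcept? r a c ×-dec (bit r a′ Boolₚ.≟ bit r c)
  local? (guess r)   a c a′ c′ = sameExcept? r a c ×-dec (bit r a Boolₚ.≟ false) ×-dec
                                 ((bit r c′ Boolₚ.≟ true) →-dec (bit r c Boolₚ.≟ true))
  local? (copy r r′) a c a′ c′ = sameExcept? r′ a c ×-dec (bit r′ a Boolₚ.≟ false) ×-dec
                                 (bit r′ c Boolₚ.≟ bit r a)
  local? (test _ _)  a c a′ c′ = same? a c
  local? stop        a c a′ c′ = same? a c

  local-blank : ∀ act → Local act wblank wblank wblank wblank
  local-blank (inc r)     = (λ _ _ → refl) , refl
  local-blank (dec r)     = (λ _ _ → refl) , refl
  local-blank (guess r)   = (λ _ _ → refl) , bit-wblank r , id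
  local-blank (copy r r′) = (λ _ _ → refl) , bit-wblank r′ , trans (bit-wblank r′) (sym (bit-wblank r))
  local-blank (test _ _) _ = refl
  local-blank stop       _ = refl

  -- emptyR and consR generate every configuration letter by letter, which makes it rigid.
  data Relation : Set where
    emptyR : Relation
    consR  : WLetter → Relation
    stepR  : S → Bool → Relation

  abstract
    finRelation : Finite Relation
    finRelation = finite-retype
      (λ { (inj₁ _) → emptyR ; (inj₂ (inj₁ a)) → consR a ; (inj₂ (inj₂ (q , b))) → stepR q b })
      (λ { emptyR → inj₁ tt ; (consR a) → inj₂ (inj₁ a) ; (stepR q b) → inj₂ (inj₂ (q , b)) })
      (λ { emptyR → refl ; (consR a) → refl ; (stepR q b) → refl })
      (λ { (inj₁ _) → refl ; (inj₂ (inj₁ a)) → refl ; (inj₂ (inj₂ (q , b))) → refl })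
      (finite-⊎ finite-⊤ (finite-⊎ finW (finite-× finS finite-Bool)))

  action : S → Bool → Action (Fin M)
  action q b = proj₁ (rule (prog q) b)

  target : S → Bool → S
  target q b = proj₂ (rule (prog q) b)

  φ₀ : Relation → WLetter → WLetter → Set
  φ₀ emptyR      a c = ⊤
  φ₀ (consR x)   a c = c ≡ x
  φ₀ (stepR q b) a c = top a ≡ just q × top c ≡ just (target q b) × Start (action q b) a c

  -- In a step the whole history of the first configuration moves down by one place, below the new
  -- control state; nothing is forgotten. For `consR` the same shift applies to entire letters.
  φ : Relation → WLetter → WLetter → WLetter → WLetter → Set
  φ emptyR      a c a′ c′ = a ≡ wblank
  φ (consR _)   a c a′ c′ = c′ ≡ a
  φ (stepR q b) a c a′ c′ = top c′ ≡ top a × Local (action q b) a c a′ c′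

  φ₀? : ∀ R a c → Dec (φ₀ R a c)
  φ₀? emptyR      a c = yes tt
  φ₀? (consR x)   a c = c ≟W x
  φ₀? (stepR q b) a c = (top a ≟T just q) ×-dec (top c ≟T just (target q b)) ×-dec start? (action q b) a c

  φ? : ∀ R a c a′ c′ → Dec (φ R a c a′ c′)
  φ? emptyR      a c a′ c′ = a ≟W wblank
  φ? (consR _)   a c a′ c′ = c′ ≟W a
  φ? (stepR q b) a c a′ c′ = (top c′ ≟T top a) ×-dec local? (action q b) a c a′ c′

  φ-blank : ∀ R → φ R wblank wblank wblank wblank
  φ-blank emptyR      = refl
  φ-blank (consR _)   = refl
  φ-blank (stepR q b) = refl , local-blank (action q b)

  module Win (R : Relation) = Window
    (λ a c → φ₀ R (proj₁ a) (proj₁ c)) (λ a c → φ₀? R (proj₁ a) (proj₁ c))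
    (λ a c a′ c′ → φ R (proj₁ a) (proj₁ c) (proj₁ a′) (proj₁ c′))
    (λ a c a′ c′ → φ? R (proj₁ a) (proj₁ c) (proj₁ a′) (proj₁ c′))
    (φ-blank R)

  -- Parity conditions on the finite sets and the automata that check them.

  data Comparison : Set where
    none even sameParity : Comparison
    bitParity : Fin M → Comparison

  comparisonOf : Action (Fin M) → Comparison
  comparisonOf (guess r) = bitParity r
  comparisonOf stop      = even
  comparisonOf _         = sameParity

  comparison : Relation → Comparison
  comparison emptyR      = none
  comparison (consR _)   = none
  comparison (stepR q b) = comparisonOf (action q b)

  -- The first component of a state records whether the end of track r has been passed,
  -- so that exactly the bit of the first word at that position is added to the sum.
  compareNext : Comparison → Bool × Bool → Letter × Letter → Bool × Bool
  compareNext none          (f , x) _ = f , x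
  compareNext even          (f , x) ((_ , h) , _) = f , x xor h
  compareNext sameParity    (f , x) ((_ , h) , (_ , h′)) = f , x xor (h xor h′)
  compareNext (bitParity r) (f , x) ((_ , h) , (c , h′)) =
    f ∨ not (bit r c) , x xor (((not f ∧ not (bit r c)) ∧ h) xor h′)

  compareA : Comparison → Automaton (Letter × Letter)
  compareA c = record
    { State = Bool × Bool ; finite = finite-× finite-Bool finite-Bool
    ; initial = false , false ; next = compareNext c ; accept = λ q → not (proj₂ q) }

  relationA : Relation → Automaton (Letter × Letter)
  relationA R = Win.windowA R ∧A compareA (comparison R)

  abstract
    relationDFA : Relation → DFA (Vec (Maybe (Fin (size finL))) 2)
    relationDFA R = toDFA (onPairs (relationA R))

    final-relationDFA : ∀ R u v →
      DFA.final (relationDFA R) (run (relationDFA R) (DFA.start (relationDFA R)) (conv (u ∷ v ∷ []))) ≡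
      Automaton.accept (relationA R)
        (runStreams (relationA R) (Automaton.initial (relationA R)) (at u) (at v) (maxLen (u ∷ v ∷ [])))
    final-relationDFA R u v = accepts-pair (relationA R) u v

  structure : AutoStruct
  structure = record
    { k = size finL ; s = size finRelation ; arity = λ _ → 2
    ; domA = normalDFA ; relA = λ i → relationDFA (elem finRelation i) }

  conf : Word → ℕ → WLetter
  conf v p = proj₁ (at v p)

  hbit : Word → ℕ → Bool
  hbit v p = proj₂ (at v p)

  parity : Word → Bool
  parity v = xorSum (length v) (hbit v)

  parity-bound : ∀ v {n} → length v ≤ n → xorSum n (hbit v) ≡ parity v
  parity-bound v len = xorSum-stable len (λ p l → cong proj₂ (at-beyond v l))

  Compared : Comparison → Word → Word → Set
  Compared none          u v = ⊤
  Compared even          u v = parity u ≡ false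
  Compared sameParity    u v = parity u ≡ parity v
  Compared (bitParity r) u v = ∃ λ y → (∀ p → bit r (conf v p) ≡ (p <ᵇ y)) × hbit u y ≡ parity v

  Shape : Relation → (ℕ → WLetter) → (ℕ → WLetter) → Set
  Shape R U V = φ₀ R (U 0) (V 0) × (∀ p → φ R (U p) (V p) (U (suc p)) (V (suc p)))

  Related : Relation → Word → Word → Set
  Related R u v = Shape R (conf u) (conf v) × Compared (comparison R) u v

  private
    sumOf : Comparison → Bool × Bool → (ℕ → Letter) → (ℕ → Letter) → ℕ → Bool
    sumOf c q U V n = proj₂ (runStreams (compareA c) q U V n)

    sum-even : ∀ n f x U V → sumOf even (f , x) U V n ≡ x xor xorSum n (proj₂ ∘ U)
    sum-even zero    f x U V = sym (Boolₚ.xor-identityʳ x)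
    sum-even (suc n) f x U V = trans (sum-even n f _ (U ∘ suc) (V ∘ suc))
      (Boolₚ.xor-assoc x (proj₂ (U 0)) _)

    sum-same : ∀ n f x U V → sumOf sameParity (f , x) U V n ≡
                             x xor (xorSum n (proj₂ ∘ U) xor xorSum n (proj₂ ∘ V))
    sum-same zero    f x U V = sym (Boolₚ.xor-identityʳ x)
    sum-same (suc n) f x U V = trans (sum-same n f _ (U ∘ suc) (V ∘ suc))
      (trans (Boolₚ.xor-assoc x _ _) (cong (x xor_) (xor-interchange (proj₂ (U 0)) (proj₂ (V 0)) _ _)))

    sum-passed : ∀ r n x U V → sumOf (bitParity r) (true , x) U V n ≡ x xor xorSum n (proj₂ ∘ V)
    sum-passed r zero    x U V = sym (Boolₚ.xor-identityʳ x)
    sum-passed r (suc n) x U V = trans (sum-passed r n _ (U ∘ suc) (V ∘ suc))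
      (Boolₚ.xor-assoc x (proj₂ (V 0)) _)

    -- The track of r ends at position y, so the only bit of the first word that enters the sum is
    -- the one at y. If y lies beyond the letters read, that bit is false and its omission changes
    -- nothing.
    sum-bit : ∀ r n x U V y → (∀ p → bit r (proj₁ (V p)) ≡ (p <ᵇ y)) → (∀ p → n ≤ p → proj₂ (U p) ≡ false) →
              sumOf (bitParity r) (false , x) U V n ≡ x xor (proj₂ (U y) xor xorSum n (proj₂ ∘ V))
    sum-bit r zero x U V y track bl rewrite bl y z≤n = sym (Boolₚ.xor-identityʳ x)
    sum-bit r (suc n) x U V zero track bl rewrite track 0 =
      trans (sum-passed r n _ (U ∘ suc) (V ∘ suc))
        (trans (Boolₚ.xor-assoc x _ _) (cong (x xor_) (Boolₚ.xor-assoc (proj₂ (U 0)) _ _)))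
    sum-bit r (suc n) x U V (suc y) track bl rewrite track 0 =
      trans (sum-bit r n _ (U ∘ suc) (V ∘ suc) y (track ∘ suc) (λ p n≤p → bl (suc p) (s≤s n≤p)))
        (trans (Boolₚ.xor-assoc x _ _) (cong (x xor_) (swap (proj₂ (V 0)) (proj₂ (U (suc y))) _)))
      where
      swap : ∀ a b c → a xor (b xor c) ≡ b xor (a xor c)
      swap a b c = trans (sym (Boolₚ.xor-assoc a b c))
        (trans (cong (_xor c) (Boolₚ.xor-comm a b)) (Boolₚ.xor-assoc b a c))

    xor-false⇒≡ : ∀ a b → not (a xor b) ≡ true → a ≡ b
    xor-false⇒≡ false false _ = refl
    xor-false⇒≡ true  true  _ = refl

    ≡⇒xor-false : ∀ a b → a ≡ b → not (a xor b) ≡ true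
    ≡⇒xor-false a .a refl = cong not (Boolₚ.xor-same a)

    ∧-split : ∀ {a b} → a ∧ b ≡ true → a ≡ true × b ≡ true
    ∧-split {true} {true} _ = refl , refl

  module _ (u v : Word) where
    private
      N : ℕ
      N = maxLen (u ∷ v ∷ [])

      u≤N : length u ≤ N
      u≤N = m≤m⊔n (length u) (length v ⊔ 0)

      v≤N : length v ≤ N
      v≤N = ≤-trans (m≤m⊔n (length v) 0) (m≤n⊔m (length u) (length v ⊔ 0))

      compareOK : Comparison → Bool
      compareOK c = not (sumOf c (false , false) (at u) (at v) N)

      parities : ∀ a → a xor xorSum N (hbit v) ≡ a xor parity v
      parities a = cong (a xor_) (parity-bound v v≤N)

    -- The automaton only sees where the track of r first stops. Monotonicity ensures that the track
    -- is the unary notation of that position.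
    compare-sound : ∀ c → (∀ {r} → c ≡ bitParity r → ∀ p → bit r (conf v (suc p)) ≡ true → bit r (conf v p) ≡ true) →
                    compareOK c ≡ true → Compared c u v
    compare-sound none mono ok = tt
    compare-sound even mono ok = Boolₚ.not-injective
      (trans (cong not (sym (trans (sum-even N false false (at u) (at v)) (parity-bound u u≤N)))) ok)
    compare-sound sameParity mono ok = xor-false⇒≡ _ _
      (trans (cong not (sym (trans (sum-same N false false (at u) (at v))
        (trans (parities (xorSum N (hbit u))) (cong (_xor parity v) (parity-bound u u≤N)))))) ok)
    compare-sound (bitParity r) mono ok
      with unary-track (λ p → bit r (conf v p)) (mono refl) (length v)
             (λ p l → trans (cong (bit r ∘ proj₁) (at-beyond v l)) (bit-wblank r))
    ... | y , track = y , track , xor-false⇒≡ _ _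
      (trans (cong not (sym (trans (sum-bit r N false (at u) (at v) y track
        (λ p l → cong proj₂ (at-beyond u (≤-trans u≤N l)))) (parities (hbit u y))))) ok)

    compare-complete : ∀ c → Compared c u v → compareOK c ≡ true
    compare-complete none _ = cong not (go N (at u) (at v))
      where
      go : ∀ n U V → sumOf none (false , false) U V n ≡ false
      go zero    U V = refl
      go (suc n) U V = go n (U ∘ suc) (V ∘ suc)
    compare-complete even eq = cong not
      (trans (sum-even N false false (at u) (at v)) (trans (parity-bound u u≤N) eq))
    compare-complete sameParity eq = trans
      (cong not (trans (sum-same N false false (at u) (at v))
        (trans (parities (xorSum N (hbit u))) (cong (_xor parity v) (parity-bound u u≤N)))))
      (≡⇒xor-false _ _ eq)
    compare-complete (bitParity r) (y , track , eq) = trans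
      (cong not (trans (sum-bit r N false (at u) (at v) y track
        (λ p l → cong proj₂ (at-beyond u (≤-trans u≤N l)))) (parities (hbit u y))))
      (≡⇒xor-false _ _ eq)

    private
      accepted : ∀ R → DFA.final (relationDFA R)
                   (run (relationDFA R) (DFA.start (relationDFA R)) (conv (u ∷ v ∷ [])))
                 ≡ Win.windowAccept R (runStreams (Win.windowA R) Win.start (at u) (at v) N)
                   ∧ compareOK (comparison R)
      accepted R = trans (final-relationDFA R u v)
        (cong (Automaton.accept (relationA R))
          (runStreams-∧A (Win.windowA R) (compareA (comparison R)) Win.start (false , false) (at u) (at v) N))

      beyond : ∀ w {n} → length w ≤ n → ∀ p → n ≤ p → at w p ≡ blank
      beyond w len p n≤p = at-beyond w (≤-trans len n≤p)

      -- The last clause of `Local` for a guess exists for this purpose: it forces the guessed track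
      -- to be an initial segment.
      monotone : ∀ R → Shape R (conf u) (conf v) → ∀ {r} → comparison R ≡ bitParity r →
                 ∀ p → bit r (conf v (suc p)) ≡ true → bit r (conf v p) ≡ true
      monotone (stepR q b) (_ , steps) eq p with action q b | proj₂ (steps p)
      monotone (stepR q b) (_ , steps) refl p | guess r | _ , _ , mono = mono

    accepts⇒related : ∀ R → Accepts (relationDFA R) (conv (u ∷ v ∷ [])) → Related R u v
    accepts⇒related R ok with ∧-split (trans (sym (accepted R)) ok)
    ... | okW , okC = shape , compare-sound (comparison R) (monotone R shape) okC
      where
      shape : Shape R (conf u) (conf v)
      shape = Win.window-sound R N (beyond u u≤N) (beyond v v≤N) okW

    related⇒accepts : ∀ R → Related R u v → Accepts (relationDFA R) (conv (u ∷ v ∷ []))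
    related⇒accepts R ((h₀ , hs) , cmp) = trans (accepted R)
      (cong₂ _∧_ (Win.window-complete R N (beyond u u≤N) (beyond v v≤N) h₀ hs)
                 (compare-complete (comparison R) cmp))

-- Lists, comparison of numbers, and the effect of actions on registers.

nth : ∀ {A : Set} → List A → ℕ → Maybe A
nth []      _       = nothing
nth (x ∷ h) zero    = just x
nth (x ∷ h) (suc p) = nth h p

nth-beyond : ∀ {A : Set} (h : List A) {p} → length h ≤ p → nth h p ≡ nothing
nth-beyond []      _         = refl
nth-beyond (x ∷ h) (s≤s len) = nth-beyond h len

nth-length-≤ : ∀ {A : Set} (h h′ : List A) → (∀ p → nth h p ≡ nth h′ p) → length h ≤ length h′
nth-length-≤ []      h′       eq = z≤n
nth-length-≤ (x ∷ h) []       eq with () ← eq 0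
nth-length-≤ (x ∷ h) (y ∷ h′) eq = s≤s (nth-length-≤ h h′ (eq ∘ suc))

maximum : ∀ {n} → (Fin n → ℕ) → ℕ
maximum {zero}  g = 0
maximum {suc n} g = g zero ⊔ maximum (g ∘ suc)

≤-maximum : ∀ {n} (g : Fin n → ℕ) i → g i ≤ maximum g
≤-maximum g zero    = m≤m⊔n (g zero) (maximum (g ∘ suc))
≤-maximum g (suc i) = ≤-trans (≤-maximum (g ∘ suc) i) (m≤n⊔m (g zero) (maximum (g ∘ suc)))

<⇒≡ᵇ-false : ∀ {m n} → n < m → (m ≡ᵇ n) ≡ false
<⇒≡ᵇ-false {suc m} {zero}  _         = refl
<⇒≡ᵇ-false {suc m} {suc n} (s≤s n<m) = <⇒≡ᵇ-false n<m

≡ᵇ-refl : ∀ n → (n ≡ᵇ n) ≡ true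
≡ᵇ-refl zero    = refl
≡ᵇ-refl (suc n) = ≡ᵇ-refl n

≢⇒≡ᵇ-false : ∀ m n → m ≢ n → (m ≡ᵇ n) ≡ false
≢⇒≡ᵇ-false zero    zero    ne = ⊥-elim (ne refl)
≢⇒≡ᵇ-false zero    (suc n) ne = refl
≢⇒≡ᵇ-false (suc m) zero    ne = refl
≢⇒≡ᵇ-false (suc m) (suc n) ne = ≢⇒≡ᵇ-false m n (ne ∘ cong suc)

-- A `guess` leaves the new content open. `guess` and `copy` ask for an empty target, so that no
-- content is overwritten and every step can be undone.
Effect : ∀ {R : Set} → Action R → (R → ℕ) → (R → ℕ) → Set
Effect (inc r)     σ σ′ = σ′ r ≡ suc (σ r) × (∀ i → i ≢ r → σ′ i ≡ σ i)
Effect (dec r)     σ σ′ = σ r ≡ suc (σ′ r) × (∀ i → i ≢ r → σ′ i ≡ σ i)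
Effect (guess r)   σ σ′ = σ r ≡ 0 × (∀ i → i ≢ r → σ′ i ≡ σ i)
Effect (copy r r′) σ σ′ = σ r′ ≡ 0 × σ′ r′ ≡ σ r × (∀ i → i ≢ r′ → σ′ i ≡ σ i)
Effect (test r b)  σ σ′ = (0 <ᵇ σ r) ≡ b × (∀ i → σ′ i ≡ σ i)
Effect stop        σ σ′ = ∀ i → σ′ i ≡ σ i

-- Configurations, their encoding as words, and uniqueness of successors and predecessors.

module Configurations {S : Set} (finS : Finite S) (M : ℕ) (prog : S → Instr S (Fin M)) where
  open Structure finS M prog public

  Registers : Set
  Registers = Fin M → ℕ

  -- The history lists all control states visited so far, the current one first.
  infix 4 _∣_
  record Config : Set where
    constructor _∣_
    field
      history   : List S
      registers : Registers
  open Config public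

  encode : Config → ℕ → WLetter
  encode (h ∣ σ) p = nth h p , tabulate (λ r → p <ᵇ σ r)

  bit-encode : ∀ c r p → bit r (encode c p) ≡ (p <ᵇ registers c r)
  bit-encode (h ∣ σ) r p = Vecₚ.lookup∘tabulate (λ r → p <ᵇ σ r) r

  private
    bit≡ : ∀ c d {r r′ p p′} → (p <ᵇ registers c r) ≡ (p′ <ᵇ registers d r′) →
           bit r (encode c p) ≡ bit r′ (encode d p′)
    bit≡ c d {r} {r′} {p} {p′} eq = trans (bit-encode c r p) (trans eq (sym (bit-encode d r′ p′)))

  module _ {h h′ : List S} {σ σ′ : Registers} where
    private
      c d : Config
      c = h ∣ σ
      d = h′ ∣ σ′

      others : ∀ {r} → (∀ i → i ≢ r → σ′ i ≡ σ i) → ∀ p → SameExcept r (encode c p) (encode d p)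
      others same p i i≢r = bit≡ d c (cong (p <ᵇ_) (same i i≢r))

    effect-start : ∀ act → Effect act σ σ′ → Start act (encode c 0) (encode d 0)
    effect-start (inc r)    (eq , _) = trans (bit-encode d r 0) (cong (0 <ᵇ_) eq)
    effect-start (dec r)    (eq , _) = trans (bit-encode c r 0) (cong (0 <ᵇ_) eq)
    effect-start (test r b) (eq , _) = trans (bit-encode c r 0) eq
    effect-start (guess _)  _ = tt
    effect-start (copy _ _) _ = tt
    effect-start stop       _ = tt

    effect-local : ∀ act → Effect act σ σ′ →
                   ∀ p → Local act (encode c p) (encode d p) (encode c (suc p)) (encode d (suc p))
    effect-local (inc r) (eq , same) p = others same p , bit≡ d c (cong (suc p <ᵇ_) eq)
    effect-local (dec r) (eq , same) p = others same p , bit≡ c d (cong (suc p <ᵇ_) eq)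
    effect-local (guess r) (eq , same) p =
      others same p , trans (bit-encode c r p) (cong (p <ᵇ_) eq) ,
      λ t → trans (bit-encode d r p) (mono p (σ′ r) (trans (sym (bit-encode d r (suc p))) t))
      where
      mono : ∀ p y → (suc p <ᵇ y) ≡ true → (p <ᵇ y) ≡ true
      mono zero    (suc y) _ = refl
      mono (suc p) (suc y) t = mono p y t
    effect-local (copy r r′) (eq , eq′ , same) p =
      others same p , trans (bit-encode c r′ p) (cong (p <ᵇ_) eq) , bit≡ d c (cong (p <ᵇ_) eq′)
    effect-local (test r b) (_ , same) p i = bit≡ d c (cong (p <ᵇ_) (same i))
    effect-local stop same p i = bit≡ d c (cong (p <ᵇ_) (same i))

  effect-shape : ∀ q b {h σ σ′} → Effect (action q b) σ σ′ →
                 Shape (stepR q b) (encode ((q ∷ h) ∣ σ)) (encode ((target q b ∷ q ∷ h) ∣ σ′))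
  effect-shape q b {h} e =
    (refl , refl , effect-start {q ∷ h} {target q b ∷ q ∷ h} (action q b) e) ,
    λ p → refl , effect-local {q ∷ h} {target q b ∷ q ∷ h} (action q b) e p

  shape-cong : ∀ R {U U′ V V′} → (∀ p → U p ≡ U′ p) → (∀ p → V p ≡ V′ p) → Shape R U V → Shape R U′ V′
  shape-cong R eu ev (h₀ , hs) = subst₂ (φ₀ R) (eu 0) (ev 0) h₀ ,
    λ p → subst₂ (φ R _ _) (eu (suc p)) (ev (suc p)) (subst₂ (λ a c → φ R a c _ _) (eu p) (ev p) (hs p))

  StepShape : S → Action (Fin M) → S → (ℕ → WLetter) → (ℕ → WLetter) → Set
  StepShape q act s U V =
    (top (U 0) ≡ just q × top (V 0) ≡ just s × Start act (U 0) (V 0)) ×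
    (∀ p → top (V (suc p)) ≡ top (U p) × Local act (U p) (V p) (U (suc p)) (V (suc p)))

  -- Each track after the step is computed from the tracks before it, except that of a guessed
  -- register, where agreement is assumed.
  step-deterministic : ∀ {q act s U V V′} → StepShape q act s U V → StepShape q act s U V′ →
    (∀ {r} → act ≡ guess r → ∀ p → bit r (V p) ≡ bit r (V′ p)) → ∀ p → V p ≡ V′ p
  step-deterministic {act = act} {U = U} {V} {V′} ((_ , v₀ , st) , loc) ((_ , v₀′ , st′) , loc′) gs p =
    bits-ext (tops p) (λ i → bits act st st′ (proj₂ ∘ loc) (proj₂ ∘ loc′) gs i p)
    where
    tops : ∀ p → top (V p) ≡ top (V′ p)
    tops zero    = trans v₀ (sym v₀′)
    tops (suc p) = trans (proj₁ (loc p)) (sym (proj₁ (loc′ p)))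
    bits : ∀ act → Start act (U 0) (V 0) → Start act (U 0) (V′ 0) →
           (∀ p → Local act (U p) (V p) (U (suc p)) (V (suc p))) →
           (∀ p → Local act (U p) (V′ p) (U (suc p)) (V′ (suc p))) →
           (∀ {r} → act ≡ guess r → ∀ p → bit r (V p) ≡ bit r (V′ p)) →
           ∀ i p → bit i (V p) ≡ bit i (V′ p)
    bits (inc r) s s′ l l′ gs i p with i Finₚ.≟ r
    bits (inc r) s s′ l l′ gs i p       | no i≢r = trans (proj₁ (l p) i i≢r) (sym (proj₁ (l′ p) i i≢r))
    -- `Local` only reaches the bits from position 1 on, which come from their left neighbours; the
    -- bit at position 0 is the one that `Start` prescribes.
    bits (inc r) s s′ l l′ gs i zero    | yes refl = trans s (sym s′)
    bits (inc r) s s′ l l′ gs i (suc p) | yes refl = trans (proj₂ (l p)) (sym (proj₂ (l′ p)))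
    bits (dec r) s s′ l l′ gs i p with i Finₚ.≟ r
    ... | no i≢r = trans (proj₁ (l p) i i≢r) (sym (proj₁ (l′ p) i i≢r))
    ... | yes refl = trans (sym (proj₂ (l p))) (proj₂ (l′ p))
    bits (guess r) s s′ l l′ gs i p with i Finₚ.≟ r
    ... | no i≢r = trans (proj₁ (l p) i i≢r) (sym (proj₁ (l′ p) i i≢r))
    ... | yes refl = gs refl p
    bits (copy r r′) s s′ l l′ gs i p with i Finₚ.≟ r′
    ... | no i≢r = trans (proj₁ (l p) i i≢r) (sym (proj₁ (l′ p) i i≢r))
    ... | yes refl = trans (proj₂ (proj₂ (l p))) (sym (proj₂ (proj₂ (l′ p))))
    bits (test r b) s s′ l l′ gs i p = trans (l p i) (sym (l′ p i))
    bits stop s s′ l l′ gs i p = trans (l p i) (sym (l′ p i))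

  -- The history of U is that of V without its first entry. A register overwritten by a guess or a
  -- copy was 0 before, and the other actions are reversible.
  step-injective : ∀ {q q′ act s s′ U U′ V} → StepShape q act s U V → StepShape q′ act s′ U′ V →
                   ∀ p → U p ≡ U′ p
  step-injective {act = act} {U = U} {U′} {V} ((_ , _ , st) , loc) ((_ , _ , st′) , loc′) p =
    bits-ext (trans (sym (proj₁ (loc p))) (proj₁ (loc′ p)))
             (λ i → bits act st st′ (proj₂ ∘ loc) (proj₂ ∘ loc′) i p)
    where
    bits : ∀ act → Start act (U 0) (V 0) → Start act (U′ 0) (V 0) →
           (∀ p → Local act (U p) (V p) (U (suc p)) (V (suc p))) →
           (∀ p → Local act (U′ p) (V p) (U′ (suc p)) (V (suc p))) →
           ∀ i p → bit i (U p) ≡ bit i (U′ p)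
    bits (inc r) s s′ l l′ i p with i Finₚ.≟ r
    ... | no i≢r = trans (sym (proj₁ (l p) i i≢r)) (proj₁ (l′ p) i i≢r)
    ... | yes refl = trans (sym (proj₂ (l p))) (proj₂ (l′ p))
    bits (dec r) s s′ l l′ i p with i Finₚ.≟ r
    bits (dec r) s s′ l l′ i p       | no i≢r = trans (sym (proj₁ (l p) i i≢r)) (proj₁ (l′ p) i i≢r)
    bits (dec r) s s′ l l′ i zero    | yes refl = trans s (sym s′)
    bits (dec r) s s′ l l′ i (suc p) | yes refl = trans (proj₂ (l p)) (sym (proj₂ (l′ p)))
    bits (guess r) s s′ l l′ i p with i Finₚ.≟ r
    ... | no i≢r = trans (sym (proj₁ (l p) i i≢r)) (proj₁ (l′ p) i i≢r)
    ... | yes refl = trans (proj₁ (proj₂ (l p))) (sym (proj₁ (proj₂ (l′ p))))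
    bits (copy r r′) s s′ l l′ i p with i Finₚ.≟ r′
    ... | no i≢r = trans (sym (proj₁ (l p) i i≢r)) (proj₁ (l′ p) i i≢r)
    ... | yes refl = trans (proj₁ (proj₂ (l p))) (sym (proj₁ (proj₂ (l′ p))))
    bits (test r b) s s′ l l′ i p = trans (sym (l p i)) (l′ p i)
    bits stop s s′ l l′ i p = trans (sym (l p i)) (l′ p i)

  shape-source : ∀ {q q′ b b′ U V V′} → Shape (stepR q b) U V → Shape (stepR q′ b′) U V′ → q ≡ q′
  shape-source ((e , _) , _) ((e′ , _) , _) = just-injective (trans (sym e) e′)

  -- The source state stands at position 1 of the history of V.
  shape-history : ∀ {q q′ b b′ U U′ V} → Shape (stepR q b) U V → Shape (stepR q′ b′) U′ V → q ≡ q′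
  shape-history ((e , _) , s) ((e′ , _) , s′) =
    just-injective (trans (sym e) (trans (sym (proj₁ (s 0))) (trans (proj₁ (s′ 0)) e′)))

  -- For a jump, `Start` determines the outcome from U, so b and b′ agree; `exec` yields the same
  -- action for both.
  shape-deterministic : ∀ {q b b′ U V V′} → Shape (stepR q b) U V → Shape (stepR q b′) U V′ →
    (∀ {r} → action q b ≡ guess r → ∀ p → bit r (V p) ≡ bit r (V′ p)) → ∀ p → V p ≡ V′ p
  shape-deterministic {q} {b} {b′} {U} {V} {V′} = go (prog q)
    where
    go : ∀ i → StepShape q (proj₁ (rule i b)) (proj₂ (rule i b)) U V →
               StepShape q (proj₁ (rule i b′)) (proj₂ (rule i b′)) U V′ →
         (∀ {r} → proj₁ (rule i b) ≡ guess r → ∀ p → bit r (V p) ≡ bit r (V′ p)) → ∀ p → V p ≡ V′ p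
    go (exec a s) sh sh′ gs = step-deterministic sh sh′ gs
    go (jump r s₀ s₁) sh@((_ , _ , st) , _) sh′@((_ , _ , st′) , _) gs with trans (sym st) st′
    ... | refl = step-deterministic {U = U} {V} {V′} sh sh′ gs

  -- A test changes no register, so after a jump U can be read off V whatever the outcomes were.
  shape-injective : ∀ {q b b′ U U′ V} → Shape (stepR q b) U V → Shape (stepR q b′) U′ V → ∀ p → U p ≡ U′ p
  shape-injective {q} {b} {b′} {U} {U′} {V} = go (prog q)
    where
    go : ∀ i → StepShape q (proj₁ (rule i b)) (proj₂ (rule i b)) U V →
               StepShape q (proj₁ (rule i b′)) (proj₂ (rule i b′)) U′ V → ∀ p → U p ≡ U′ p
    go (exec a s) sh sh′ = step-injective sh sh′
    go (jump r s₀ s₁) (_ , loc) (_ , loc′) p =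
      bits-ext (trans (sym (proj₁ (loc p))) (proj₁ (loc′ p)))
               (λ i → trans (sym (proj₂ (loc p) i)) (proj₂ (loc′ p) i))

  action-guess : ∀ {q b b′ r} → action q b ≡ guess r → action q b′ ≡ guess r
  action-guess {q} {b} {b′} {r} = go (prog q)
    where
    go : ∀ i → proj₁ (rule i b) ≡ guess r → proj₁ (rule i b′) ≡ guess r
    go (exec a s) eq = eq

  action-stop : ∀ {q b b′} → action q b ≡ stop → action q b′ ≡ stop
  action-stop {q} {b} {b′} = go (prog q)
    where
    go : ∀ i → proj₁ (rule i b) ≡ stop → proj₁ (rule i b′) ≡ stop
    go (exec a s) eq = eq

  bound : Config → ℕ
  bound c = length (history c) ⊔ maximum (registers c)

  encode-beyond : ∀ c p → bound c ≤ p → encode c p ≡ wblank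
  encode-beyond c p b≤p = bits-ext
    (nth-beyond (history c) (≤-trans (m≤m⊔n (length (history c)) _) b≤p))
    (λ r → trans (bit-encode c r p) (trans
      (≤⇒≮ᵇ (≤-trans (≤-maximum (registers c) r) (≤-trans (m≤n⊔m (length (history c)) _) b≤p)))
      (sym (bit-wblank r))))

  -- The word over c with the empty finite set. It serves as the canonical name of c: `strip`
  -- reduces every word over c to it.
  node : Config → Word
  node c = fromStream (λ p → encode c p , false) (bound c)

  node-normal : ∀ c → Normal (node c)
  node-normal c = fromStream-normal (λ p → encode c p , false) (bound c)

  at-node : ∀ c p → at (node c) p ≡ (encode c p , false)
  at-node c = at-fromStream (λ p → encode c p , false) (bound c)
                            (λ p b≤p → cong (_, false) (encode-beyond c p b≤p))

  conf-node : ∀ c p → conf (node c) p ≡ encode c p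
  conf-node c p = cong proj₁ (at-node c p)

  parity-node : ∀ c → parity (node c) ≡ false
  parity-node c = xorSum-false (length (node c)) (λ p → cong proj₂ (at-node c p))

  strip : Word → Word
  strip v = fromStream (λ p → conf v p , false) (length v)

  strip-normal : ∀ v → Normal (strip v)
  strip-normal v = fromStream-normal (λ p → conf v p , false) (length v)

  at-strip : ∀ v p → at (strip v) p ≡ (conf v p , false)
  at-strip v = at-fromStream (λ p → conf v p , false) (length v)
                             (λ p l → cong (λ a → proj₁ a , false) (at-beyond v l))

  strip-length : ∀ v → length (strip v) ≤ length v
  strip-length v = fromStream-length (λ p → conf v p , false) (length v)

  Over : Word → Config → Set
  Over v c = ∀ p → conf v p ≡ encode c p

  over⇒strip : ∀ v c → Over v c → strip v ≡ node c
  over⇒strip v c over = normal-ext (strip v) (node c) (strip-normal v) (node-normal c)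
    (λ p → trans (at-strip v p) (trans (cong (_, false) (over p)) (sym (at-node c p))))

  strip⇒over : ∀ v c → strip v ≡ node c → Over v c
  strip⇒over v c eq p = cong proj₁ (trans (sym (at-strip v p)) (trans (cong (λ w → at w p) eq) (at-node c p)))

  strip-cong : ∀ u v → (∀ p → conf u p ≡ conf v p) → strip u ≡ strip v
  strip-cong u v eq = normal-ext (strip u) (strip v) (strip-normal u) (strip-normal v)
    (λ p → trans (at-strip u p) (trans (cong (_, false) (eq p)) (sym (at-strip v p))))

  -- Neither the history nor a register reaches beyond the end of the word. Read contrapositively, a
  -- configuration with a large sum is not named by any short word.
  node-length : ∀ c r → length (history c) + registers c r ≤ length (node c) + length (node c)
  node-length c r = ℕₚ.+-mono-≤ (hist (history c) refl) reg
    where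
    blankAt : ∀ {p} → length (node c) ≤ p → encode c p ≡ wblank
    blankAt {p} l = trans (sym (conf-node c p)) (cong proj₁ (at-beyond (node c) l))
    long : ∀ {A : Set} (h : List A) n → (∀ p → n ≤ p → nth h p ≡ nothing) → length h ≤ n
    long []      n       _  = z≤n
    long (x ∷ h) zero    bl with () ← bl 0 z≤n
    long (x ∷ h) (suc n) bl = s≤s (long h n (λ p l → bl (suc p) (s≤s l)))
    hist : ∀ h → h ≡ history c → length h ≤ length (node c)
    hist h refl = long h (length (node c)) (λ p l → cong top (blankAt l))
    <ᵇ-bound : ∀ m n → (m <ᵇ n) ≡ false → n ≤ m
    <ᵇ-bound m       zero    _  = z≤n
    <ᵇ-bound (suc m) (suc n) eq = s≤s (<ᵇ-bound m n eq)
    reg : registers c r ≤ length (node c)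
    reg = <ᵇ-bound (length (node c)) (registers c r) (trans (sym (bit-encode c r (length (node c))))
      (trans (cong (bit r) (blankAt ≤-refl)) (bit-wblank r)))

  -- Symmetric difference of the finite set with the singleton of y; the bound on the length leaves
  -- room for y.
  flip : ℕ → Word → Word
  flip y v = fromStream (λ p → conf v p , hbit v p xor (p ≡ᵇ y)) (length v ⊔ suc y)

  flip-normal : ∀ y v → Normal (flip y v)
  flip-normal y v = fromStream-normal (λ p → conf v p , hbit v p xor (p ≡ᵇ y)) (length v ⊔ suc y)

  at-flip : ∀ y v p → at (flip y v) p ≡ (conf v p , hbit v p xor (p ≡ᵇ y))
  at-flip y v = at-fromStream (λ p → conf v p , hbit v p xor (p ≡ᵇ y)) (length v ⊔ suc y) bl
    where
    bl : ∀ p → length v ⊔ suc y ≤ p → (conf v p , hbit v p xor (p ≡ᵇ y)) ≡ blank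
    bl p l = cong₂ _,_ (cong proj₁ (at-beyond v l₁)) (cong₂ _xor_ (cong proj₂ (at-beyond v l₁)) (<⇒≡ᵇ-false l₂))
      where
      l₁ : length v ≤ p
      l₁ = ≤-trans (m≤m⊔n (length v) (suc y)) l
      l₂ : y < p
      l₂ = ≤-trans (m≤n⊔m (length v) (suc y)) l

  parity-flip : ∀ y v → parity (flip y v) ≡ not (parity v)
  parity-flip y v = begin
    parity (flip y v)                             ≡⟨ parity-bound (flip y v) (fromStream-length _ N) ⟨
    xorSum N (hbit (flip y v))                    ≡⟨ xorSum-cong N (λ p → cong proj₂ (at-flip y v p)) ⟩
    xorSum N (λ p → hbit v p xor (p ≡ᵇ y))        ≡⟨ xorSum-xor N (hbit v) (_≡ᵇ y) ⟩
    xorSum N (hbit v) xor xorSum N (_≡ᵇ y)        ≡⟨ cong₂ _xor_ (parity-bound v (m≤m⊔n (length v) (suc y))) single ⟩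
    parity v xor true                             ≡⟨ Boolₚ.xor-comm (parity v) true ⟩
    not (parity v)                                ∎
    where
    open ≡-Reasoning
    N : ℕ
    N = length v ⊔ suc y
    single : xorSum N (_≡ᵇ y) ≡ true
    single = trans (xorSum-cong N (λ p → sym (Boolₚ.∧-identityʳ (p ≡ᵇ y))))
                   (xorSum-single (m≤n⊔m (length v) (suc y)) (λ _ → true))

  flip-involutive : ∀ y v → Normal v → flip y (flip y v) ≡ v
  flip-involutive y v nv = normal-ext _ v (flip-normal y (flip y v)) nv λ p →
    trans (at-flip y (flip y v) p) (cong₂ _,_ (cong proj₁ (at-flip y v p))
      (trans (cong (λ a → proj₂ a xor (p ≡ᵇ y)) (at-flip y v p))
        (trans (Boolₚ.xor-assoc (hbit v p) (p ≡ᵇ y) (p ≡ᵇ y))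
          (trans (cong (hbit v p xor_) (Boolₚ.xor-same (p ≡ᵇ y))) (Boolₚ.xor-identityʳ (hbit v p))))))

  flipAt : Maybe ℕ → Word → Word
  flipAt nothing  v = v
  flipAt (just y) v = flip y v

  flipAt-normal : ∀ m v → Normal v → Normal (flipAt m v)
  flipAt-normal nothing  v nv = nv
  flipAt-normal (just y) v nv = flip-normal y v

  conf-flipAt : ∀ m v p → conf (flipAt m v) p ≡ conf v p
  conf-flipAt nothing  v p = refl
  conf-flipAt (just y) v p = cong proj₁ (at-flip y v p)

  flipAt-involutive : ∀ m v → Normal v → flipAt m (flipAt m v) ≡ v
  flipAt-involutive nothing  v nv = refl
  flipAt-involutive (just y) v nv = flip-involutive y v nv

  strip-flipAt : ∀ m v → strip (flipAt m v) ≡ strip v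
  strip-flipAt m v = strip-cong (flipAt m v) v (conf-flipAt m v)

-- Paths of configurations and the twists along them.

lookup-maxLen : ∀ {A : Set} {n} (ws : Vec (List A) n) i → length (lookup ws i) ≤ maxLen ws
lookup-maxLen (w ∷ ws) zero    = m≤m⊔n (length w) (maxLen ws)
lookup-maxLen (w ∷ ws) (suc i) = ≤-trans (lookup-maxLen ws i) (m≤n⊔m (length w) (maxLen ws))

map-cong-lookup : ∀ {A B : Set} {n} {f g : A → B} (xs : Vec A n) →
                  (∀ i → f (lookup xs i) ≡ g (lookup xs i)) → Vec.map f xs ≡ Vec.map g xs
map-cong-lookup []       eq = refl
map-cong-lookup (x ∷ xs) eq = cong₂ _∷_ (eq zero) (map-cong-lookup xs (eq ∘ suc))

lookup-++-all : ∀ {A : Set} {P : A → Set} {m n} (xs : Vec A m) {ys : Vec A n} →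
                (∀ i → P (lookup xs i)) → (∀ i → P (lookup ys i)) → ∀ i → P (lookup (xs ++ ys) i)
lookup-++-all []       px py i       = py i
lookup-++-all (x ∷ xs) px py zero    = px zero
lookup-++-all {P = P} (x ∷ xs) px py (suc i) = lookup-++-all {P = P} xs (px ∘ suc) py i

nothing≢just : ∀ {A : Set} {x : A} → nothing ≢ just x
nothing≢just ()

module Twisting {S : Set} (finS : Finite S) (M : ℕ) (prog : S → Instr S (Fin M)) where
  open Configurations finS M prog public

  -- Twists flip over every configuration that a step leaves. Steps from a `stop` are excluded,
  -- since a flip there would violate the condition `even`.
  data Step : Config → Config → Set where
    step : ∀ {q h σ σ′} b → action q b ≢ stop → Effect (action q b) σ σ′ →
           Step (q ∷ h ∣ σ) (target q b ∷ q ∷ h ∣ σ′)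

  infixr 5 _◅_ _◅◅_
  data Path : Config → Config → Set where
    ε   : ∀ {c} → Path c c
    _◅_ : ∀ {c d e} → Step c d → Path d e → Path c e

  _◅◅_ : ∀ {c d e} → Path c d → Path d e → Path c e
  ε        ◅◅ p′ = p′
  (st ◅ p) ◅◅ p′ = st ◅ (p ◅◅ p′)

  guessed : Action (Fin M) → Registers → ℕ
  guessed (guess r) σ = σ r
  -- Without a guess the relations only see the parity of the finite set, so any number may be
  -- flipped; 0 is an arbitrary choice.
  guessed _         σ = 0

  flipped : ∀ {c d} → Step c d → ℕ
  flipped (step {q} {σ′ = σ′} b _ _) = guessed (action q b) σ′

  _≟w_ : DecidableEquality Word
  _≟w_ = Listₚ.≡-dec Finₚ._≟_

  -- The number to flip over the configuration named by w, if any. Nothing is flipped over the end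
  -- of the path, which is where relations may break.
  twistAt : ∀ {c e} → Path c e → Word → Maybe ℕ
  twistAt ε w = nothing
  twistAt (_◅_ {c} st p) w with w ≟w node c
  ... | yes _ = just (flipped st)
  ... | no  _ = twistAt p w

  twistAt-head : ∀ {c d e} (st : Step c d) (p : Path d e) {w} → w ≡ node c → twistAt (st ◅ p) w ≡ just (flipped st)
  twistAt-head {c} st p {w} eq with w ≟w node c
  ... | yes _ = refl
  ... | no ne = ⊥-elim (ne eq)

  twistAt-tail : ∀ {c d e} (st : Step c d) (p : Path d e) {w} → w ≢ node c → twistAt (st ◅ p) w ≡ twistAt p w
  twistAt-tail {c} st p {w} ne with w ≟w node c
  ... | yes eq = ⊥-elim (ne eq)
  ... | no _ = refl

  twistAt-◅◅ : ∀ {c d e} (p : Path c d) (p′ : Path d e) {w} → twistAt p′ w ≡ nothing →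
               twistAt (p ◅◅ p′) w ≡ twistAt p w
  twistAt-◅◅ ε p′ eq = eq
  twistAt-◅◅ (_◅_ {c} st p) p′ {w} eq with w ≟w node c
  ... | yes _ = refl
  ... | no _ = twistAt-◅◅ p p′ eq

  step-shape : ∀ {c d} → Step c d → ∃ λ q → ∃ λ b →
               Shape (stepR q b) (encode c) (encode d) × action q b ≢ stop
  step-shape (step {q} b ns e) = q , b , effect-shape q b e , ns

  history-grows : ∀ {c d} → Step c d → length (history c) < length (history d)
  history-grows (step b _ _) = ≤-refl

  node-history : ∀ c d → node c ≡ node d → length (history c) ≤ length (history d)
  node-history c d eq = nth-length-≤ (history c) (history d) λ p →
    cong top (trans (sym (conf-node c p)) (trans (cong (λ w → conf w p) eq) (conf-node d p)))

  -- Histories grow along a path, so it never meets a configuration with a shorter history than its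
  -- first one.
  twistAt-earlier : ∀ {c d e} (p : Path d e) → length (history c) < length (history d) → twistAt p (node c) ≡ nothing
  twistAt-earlier ε lt = refl
  twistAt-earlier {c} (_◅_ {d} st p) lt with node c ≟w node d
  ... | yes eq = ⊥-elim (ℕₚ.<⇒≱ lt (node-history d c (sym eq)))
  ... | no _ = twistAt-earlier {c} p (ℕₚ.<-trans lt (history-grows st))

  -- If the action is a guess, y is the number guessed on the way to v; for other actions the
  -- condition is void.
  Matches : Action (Fin M) → ℕ → Word → Set
  Matches act y v = ∀ {r} → act ≡ guess r → ∀ p → bit r (conf v p) ≡ (p <ᵇ y)

  guessed-track : ∀ {c d} (st : Step c d) {q b b′ r} → proj₁ (step-shape st) ≡ q → proj₁ (proj₂ (step-shape st)) ≡ b′ →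
                  action q b ≡ guess r → ∀ p → bit r (encode d p) ≡ (p <ᵇ flipped st)
  guessed-track (step {q} {h} {σ} {σ′} b′ _ _) {b = b} {r = r} refl refl eq p
    with action q b′ | action-guess {q} {b} {b′} eq
  ... | guess _ | refl = bit-encode (target q b′ ∷ q ∷ h ∣ σ′) r p

  module _ {q : S} {b : Bool} {u v : Word} (shape : Shape (stepR q b) (conf u) (conf v)) where

    shape-next : ∀ {c d} (st : Step c d) → strip u ≡ node c → Matches (action q b) (flipped st) v → strip v ≡ node d
    shape-next {c} {d} st eq match with step-shape st in sh
    ... | q′ , b′ , shape′ , _
      with refl ← shape-source {q} {q′} {b} {b′} (shape-cong (stepR q b) (strip⇒over u c eq) (λ _ → refl) shape) shape′ =
      over⇒strip v d (shape-deterministic {q} {b} {b′}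
        (shape-cong (stepR q b) (strip⇒over u c eq) (λ _ → refl) shape) shape′
        (λ {r} g p → trans (match g p)
          (sym (guessed-track st {q} {b} {b′} (cong proj₁ sh) (cong (proj₁ ∘ proj₂) sh) g p))))

    shape-previous : ∀ {c d} (st : Step c d) → strip v ≡ node d →
                     strip u ≡ node c × Matches (action q b) (flipped st) v
    shape-previous {c} {d} st eq with step-shape st in sh
    ... | q′ , b′ , shape′ , _
      with refl ← shape-history {q} {q′} {b} {b′} (shape-cong (stepR q b) (λ _ → refl) (strip⇒over v d eq) shape) shape′ =
      over⇒strip u c (shape-injective {q} {b} {b′}
        (shape-cong (stepR q b) (λ _ → refl) (strip⇒over v d eq) shape) shape′) ,
      λ {r} g p → trans (cong (bit r) (strip⇒over v d eq p))
        (guessed-track st {q} {b} {b′} (cong proj₁ sh) (cong (proj₁ ∘ proj₂) sh) g p)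

    -- If u lies over a configuration that the path leaves and v records the same guess, then by
    -- uniqueness of successors v lies over the next configuration of the path. This one is flipped
    -- as well unless it is the end.
    twist-forward : ∀ {c e} (p : Path c e) → strip v ≢ node e → ∀ {y} → twistAt p (strip u) ≡ just y →
                    Matches (action q b) y v → ∃ λ z → twistAt p (strip v) ≡ just z
    twist-forward (_◅_ {c} {d} st p) ne eq match with strip v ≟w node c
    ... | yes _ = _ , refl
    ... | no _ with strip u ≟w node c
    ...   | no _ = twist-forward p ne eq match
    twist-forward (st ◅ ε) ne refl match | no _ | yes u≡ = ⊥-elim (ne (shape-next st u≡ match))
    twist-forward (st ◅ (st′ ◅ p)) ne refl match | no _ | yes u≡ =
      _ , twistAt-head st′ p (shape-next st u≡ match)

    -- By uniqueness of predecessors, if v lies over a flipped configuration other than the first,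
    -- then u lies over the one before it on the path.
    twist-backward : ∀ {c e} (p : Path c e) → ∀ {z} → twistAt p (strip v) ≡ just z →
                     strip v ≡ node c ⊎ ∃ λ y → twistAt p (strip u) ≡ just y × Matches (action q b) y v
    twist-backward (_◅_ {c} {d} st p) eq with strip v ≟w node c
    ... | yes v≡ = inj₁ v≡
    ... | no _ with twist-backward p eq
    ...   | inj₁ v≡ = inj₂ (flipped st , twistAt-head st p (proj₁ (shape-previous st v≡)) , proj₂ (shape-previous st v≡))
    ...   | inj₂ (y , eq′ , match) = inj₂ (y , trans (twistAt-tail st p ne) eq′ , match)
      where
      ne : strip u ≢ node c
      ne u≡ = nothing≢just (trans (sym (twistAt-earlier {c} p (history-grows st)))
                                  (trans (cong (twistAt p) (sym u≡)) eq′))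

    -- No step of a path leaves a `stop`.
    twist-stop : ∀ {c e} (p : Path c e) → action q b ≡ stop → twistAt p (strip u) ≡ nothing
    twist-stop ε _ = refl
    twist-stop (_◅_ {c} st p) eq with strip u ≟w node c
    ... | no _ = twist-stop p eq
    ... | yes u≡ with step-shape st
    ...   | q′ , b′ , shape′ , ns
      with refl ← shape-source {q} {q′} {b} {b′} (shape-cong (stepR q b) (strip⇒over u c u≡) (λ _ → refl) shape) shape′ =
      ⊥-elim (ns (action-stop {q} {b} {b′} eq))

    -- A successor has at least two entries in its history.
    twist-start : ∀ {s σ} → strip v ≢ node (s ∷ [] ∣ σ)
    twist-start {s} {σ} v≡ = nothing≢just (trans (sym (cong top (strip⇒over v (s ∷ [] ∣ σ) v≡ 1)))
      (trans (proj₁ (proj₂ shape 0)) (proj₁ (proj₁ shape))))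

  parity-flipAt : ∀ m v → parity (flipAt m v) ≡ is-just m xor parity v
  parity-flipAt nothing  v = refl
  parity-flipAt (just y) v = parity-flip y v

  hbit-flip-same : ∀ y v → hbit (flip y v) y ≡ not (hbit v y)
  hbit-flip-same y v = trans (cong proj₂ (at-flip y v y))
    (trans (cong (hbit v y xor_) (≡ᵇ-refl y)) (Boolₚ.xor-comm (hbit v y) true))

  hbit-flip-other : ∀ {y z} v → z ≢ y → hbit (flip y v) z ≡ hbit v z
  hbit-flip-other {y} {z} v ne = trans (cong proj₂ (at-flip y v z))
    (trans (cong (hbit v z xor_) (≢⇒≡ᵇ-false z y ne)) (Boolₚ.xor-identityʳ (hbit v z)))

  -- For a guess of y, a flip of v changes the parity on the right, and a flip of u at y′ changes
  -- the bit on the left exactly if y′ is y; the hypotheses make the two changes coincide. For other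
  -- actions both parities change or neither does.
  flip-compared : ∀ act m m′ u v →
    (∀ {y} → m ≡ just y → Matches act y v → ∃ λ z → m′ ≡ just z) →
    (∀ {z} → m′ ≡ just z → ∃ λ y → m ≡ just y × Matches act y v) →
    (act ≡ stop → m ≡ nothing) →
    Compared (comparisonOf act) u v → Compared (comparisonOf act) (flipAt m u) (flipAt m′ v)
  flip-compared act m m′ u v forward backward stopped = go act refl
    where
    same : (∀ {y} → Matches act y v) → parity u ≡ parity v → parity (flipAt m u) ≡ parity (flipAt m′ v)
    same match eq = trans (parity-flipAt m u) (trans (cong₂ _xor_ (agree m m′ forward backward) eq) (sym (parity-flipAt m′ v)))
      where
      agree : ∀ m m′ → (∀ {y} → m ≡ just y → Matches act y v → ∃ λ z → m′ ≡ just z) →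
              (∀ {z} → m′ ≡ just z → ∃ λ y → m ≡ just y × Matches act y v) → is-just m ≡ is-just m′
      agree nothing  nothing  f g = refl
      agree (just _) (just _) f g = refl
      agree (just y) nothing  f g with () ← proj₂ (f refl (match {y}))
      agree nothing  (just z) f g with () ← proj₁ (proj₂ (g refl))
    bits : ∀ {r y} → act ≡ guess r → (∀ p → bit r (conf v p) ≡ (p <ᵇ y)) → hbit u y ≡ parity v →
           ∀ m m′ → (∀ {y} → m ≡ just y → Matches act y v → ∃ λ z → m′ ≡ just z) →
           (∀ {z} → m′ ≡ just z → ∃ λ y → m ≡ just y × Matches act y v) →
           hbit (flipAt m u) y ≡ parity (flipAt m′ v)
    bits g track eq nothing  nothing  _ _ = eq
    bits g track eq nothing  (just z) _ b with () ← proj₁ (proj₂ (b refl))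
    bits {r} {y} refl track eq (just y′) (just z) _ b with b refl
    ... | _ , refl , match with <ᵇ-injective y y′ (λ p → trans (sym (track p)) (match refl p))
    ...   | refl = trans (hbit-flip-same y u) (trans (cong not eq) (sym (parity-flip z v)))
    bits {r} {y} refl track eq (just y′) nothing f _ = trans (hbit-flip-other u ne) eq
      where
      ne : y ≢ y′
      ne refl with () ← proj₂ (f refl (λ { refl → track }))
    go : ∀ act′ → act′ ≡ act → Compared (comparisonOf act′) u v →
         Compared (comparisonOf act′) (flipAt m u) (flipAt m′ v)
    go (inc _)    refl eq = same (λ ()) eq
    go (dec _)    refl eq = same (λ ()) eq
    go (copy _ _) refl eq = same (λ ()) eq
    go (test _ _) refl eq = same (λ ()) eq
    go stop       refl eq rewrite stopped refl = eq
    go (guess r)  refl (y , track , eq) =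
      y , (λ p → trans (cong (bit r) (conf-flipAt m′ v p)) (track p)) ,
      bits refl track eq m m′ forward backward

  twist : ∀ {c e} → Path c e → Word → Word
  twist p v = flipAt (twistAt p (strip v)) v

  -- Twists keep configurations, so only the parity condition needs an argument. Since the path
  -- begins with a history of one entry, v cannot lie over its first configuration, and a flip over
  -- v is always matched by one over u.
  twist-related : ∀ {s σ e} (p : Path (s ∷ [] ∣ σ) e) R u v → strip v ≢ node e →
                  Related R u v → Related R (twist p u) (twist p v)
  twist-related {s} {σ} p R u v ne (shape , cmp) =
    shape-cong R (λ i → sym (conf-flipAt (twistAt p (strip u)) u i))
                 (λ i → sym (conf-flipAt (twistAt p (strip v)) v i)) shape ,
    compared R shape cmp
    where
    compared : ∀ R → Shape R (conf u) (conf v) → Compared (comparison R) u v →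
               Compared (comparison R) (twist p u) (twist p v)
    compared emptyR      _ _ = tt
    compared (consR _)   _ _ = tt
    compared (stepR q b) shape cmp =
      flip-compared (action q b) (twistAt p (strip u)) (twistAt p (strip v)) u v
        (twist-forward {q} {b} {u} {v} shape p ne)
        back
        (twist-stop {q} {b} {u} {v} shape p)
        cmp
      where
      back : ∀ {z} → twistAt p (strip v) ≡ just z →
             ∃ λ y → twistAt p (strip u) ≡ just y × Matches (action q b) y v
      back eq with twist-backward {q} {b} {u} {v} shape p eq
      ... | inj₁ v≡ = ⊥-elim (twist-start {q} {b} {u} {v} shape {s} {σ} v≡)
      ... | inj₂ r = r

-- Automorphisms preserve parities over safe configurations.

agree-on-false : ∀ {a b} → (a ≡ false → b ≡ false) → (b ≡ false → a ≡ false) → b ≡ a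
agree-on-false {false} {b}     f g = f refl
agree-on-false {true}  {true}  f g = refl
agree-on-false {true}  {false} f g = sym (g refl)

module ScottRank {S : Set} (finS : Finite S) (M : ℕ) (prog : S → Instr S (Fin M)) where
  open Twisting finS M prog public

  Element : Set
  Element = Dom structure

  wordOf : Element → Word
  wordOf = Dom.word

  element-ext : ∀ {x y : Element} → wordOf x ≡ wordOf y → x ≡ y
  element-ext {el w n} {el .w n′} refl = cong (el w) (Decidable⇒UIP.≡-irrelevant Boolₚ._≟_ n n′)

  holds⇒related : ∀ R x y → Holds structure (index finRelation R) (x ∷ y ∷ []) → Related R (wordOf x) (wordOf y)
  holds⇒related R x y h = subst (λ R′ → Related R′ (wordOf x) (wordOf y)) (elem-index finRelation R)
    (accepts⇒related (wordOf x) (wordOf y) (elem finRelation (index finRelation R)) h)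

  related⇒holds : ∀ R x y → Related R (wordOf x) (wordOf y) → Holds structure (index finRelation R) (x ∷ y ∷ [])
  related⇒holds R x y r = related⇒accepts (wordOf x) (wordOf y) (elem finRelation (index finRelation R))
    (subst (λ R′ → Related R′ (wordOf x) (wordOf y)) (sym (elem-index finRelation R)) r)

  nodeElement : Config → Element
  nodeElement c = el (node c) (node-normal c)

  -- A well-founded tree of continuations ending in `stop`: after a guess all numbers are followed,
  -- elsewhere one successor is. This is the induction along which parities are shown to be fixed.
  data Safe : Config → Set where
    safe-stop  : ∀ {q h σ} → action q false ≡ stop → Safe (q ∷ h ∣ σ)
    safe-step  : ∀ {q h σ σ′} b → comparisonOf (action q b) ≡ sameParity → Effect (action q b) σ σ′ →
                 Safe (target q b ∷ q ∷ h ∣ σ′) → Safe (q ∷ h ∣ σ)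
    safe-guess : ∀ {q h σ r} → action q false ≡ guess r →
                 (∀ y → ∃ λ σ′ → σ′ r ≡ y × Effect (guess r) σ σ′ × Safe (target q false ∷ q ∷ h ∣ σ′)) →
                 Safe (q ∷ h ∣ σ)

  module _ (f : Element → Element)
           (pres : ∀ i (t : Vec Element 2) → (Holds structure i t → Holds structure i (Vec.map f t)) ×
                                             (Holds structure i (Vec.map f t) → Holds structure i t)) where

    private
      F : Element → Word
      F x = wordOf (f x)

    preserves : ∀ R x y → Related R (wordOf x) (wordOf y) → Related R (F x) (F y)
    preserves R x y r = holds⇒related R (f x) (f y)
      (proj₁ (pres (index finRelation R) (x ∷ y ∷ [])) (related⇒holds R x y r))

    reflects : ∀ R x y → Related R (F x) (F y) → Related R (wordOf x) (wordOf y)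
    reflects R x y r = holds⇒related R x y
      (proj₂ (pres (index finRelation R) (x ∷ y ∷ [])) (related⇒holds R (f x) (f y) r))

    -- `emptyR` characterises the blank configuration, and `consR` leads from the tail of a word to
    -- the word. Both ignore the finite sets, which therefore remain free to move.
    conf-fixed : ∀ v (nv : Normal v) p → conf (F (el v nv)) p ≡ conf v p
    conf-fixed [] nv p = proj₂ (proj₁ (preserves emptyR (el [] nv) (el [] nv) ((tt , λ _ → refl) , tt))) p
    conf-fixed (a ∷ v) nv p = by p
      where
      nv′ : Normal v
      nv′ = normal-tail a v nv
      rel : Related (consR (proj₁ (elem finL a))) (F (el v nv′)) (F (el (a ∷ v) nv))
      rel = preserves (consR (proj₁ (elem finL a))) (el v nv′) (el (a ∷ v) nv) ((refl , λ _ → refl) , tt)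
      by : ∀ p → conf (F (el (a ∷ v) nv)) p ≡ conf (a ∷ v) p
      by zero    = proj₁ (proj₁ rel)
      by (suc p) = trans (proj₂ (proj₁ rel) p) (conf-fixed v nv′ p)

    over-fixed : ∀ x c → Over (wordOf x) c → Over (F x) c
    over-fixed (el v nv) c over p = trans (conf-fixed v nv p) (over p)

    module _ {c d : Config} {q : S} {b : Bool} (shape : Shape (stepR q b) (encode c) (encode d))
             (x : Element) (over : Over (wordOf x) c) where
      private
        z : Element
        z = nodeElement d

        shape-x : Shape (stepR q b) (conf (wordOf x)) (conf (wordOf z))
        shape-x = shape-cong (stepR q b) (λ p → sym (over p)) (λ p → sym (conf-node d p)) shape

        shape-F : Shape (stepR q b) (conf (F x)) (conf (F z))
        shape-F = shape-cong (stepR q b) (λ p → sym (over-fixed x c over p))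
                    (λ p → sym (over-fixed z d (conf-node d) p)) shape

      -- As f keeps configurations, the shape of the relation holds both before and after applying
      -- f; what f transports is the parity condition alone.
      compared-fixed : ∀ {cmp} → comparisonOf (action q b) ≡ cmp →
                       (Compared cmp (wordOf x) (node d) → Compared cmp (F x) (F z)) ×
                       (Compared cmp (F x) (F z) → Compared cmp (wordOf x) (node d))
      compared-fixed refl = (λ cmp → proj₂ (preserves (stepR q b) x z (shape-x , cmp))) ,
                            (λ cmp → proj₂ (reflects (stepR q b) x z (shape-F , cmp)))

    -- The element x is compared with the node of a successor, whose even parity is preserved by
    -- induction. After a guess of y this decides whether y belongs to the finite set of x; all y
    -- together fix the set and hence its parity.
    parity-fixed : ∀ {c} → Safe c → ∀ x → Over (wordOf x) c → parity (F x) ≡ parity (wordOf x)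
    parity-fixed (safe-stop {q} {h} {σ} eq) x over = agree-on-false (proj₁ fixed) (proj₂ fixed)
      where
      c d : Config
      c = q ∷ h ∣ σ
      -- A formal successor of the rejecting configuration: the binary relation for `stop` needs a
      -- second argument, although its parity condition speaks of the first.
      d = target q false ∷ q ∷ h ∣ σ
      fixed : (parity (wordOf x) ≡ false → parity (F x) ≡ false) × (parity (F x) ≡ false → parity (wordOf x) ≡ false)
      fixed = compared-fixed {c} {d} {q} {false}
        (effect-shape q false (subst (λ a → Effect a σ σ) (sym eq) (λ _ → refl))) x over (cong comparisonOf eq)
    parity-fixed (safe-step {q} {h} {σ} {σ′} b eq e safe) x over =
      agree-on-false (λ px → trans (proj₁ fixed (trans px (sym (parity-node d)))) zero-F)
                     (λ pF → trans (proj₂ fixed (trans pF (sym zero-F))) (parity-node d))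
      where
      c d : Config
      c = q ∷ h ∣ σ
      d = target q b ∷ q ∷ h ∣ σ′
      zero-F : parity (F (nodeElement d)) ≡ false
      zero-F = trans (parity-fixed safe (nodeElement d) (conf-node d)) (parity-node d)
      fixed : (parity (wordOf x) ≡ parity (node d) → parity (F x) ≡ parity (F (nodeElement d))) ×
              (parity (F x) ≡ parity (F (nodeElement d)) → parity (wordOf x) ≡ parity (node d))
      fixed = compared-fixed {c} {d} {q} {b} (effect-shape q b e) x over eq
    parity-fixed (safe-guess {q} {h} {σ} {r} eq children) x over = begin
      parity (F x)                         ≡⟨ parity-bound (F x) (m≤m⊔n (length (F x)) (length (wordOf x))) ⟨
      xorSum N (hbit (F x))                ≡⟨ xorSum-cong N bits ⟩
      xorSum N (hbit (wordOf x))           ≡⟨ parity-bound (wordOf x) (m≤n⊔m (length (F x)) (length (wordOf x))) ⟩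
      parity (wordOf x)                    ∎
      where
      open ≡-Reasoning
      N : ℕ
      N = length (F x) ⊔ length (wordOf x)
      child : ∀ σ′ → Effect (guess r) σ σ′ → Safe (target q false ∷ q ∷ h ∣ σ′) →
              hbit (F x) (σ′ r) ≡ hbit (wordOf x) (σ′ r)
      child σ′ e safe = agree-on-false to from
        where
        c d : Config
        c = q ∷ h ∣ σ
        d = target q false ∷ q ∷ h ∣ σ′
        zero-F : parity (F (nodeElement d)) ≡ false
        zero-F = trans (parity-fixed safe (nodeElement d) (conf-node d)) (parity-node d)
        track : ∀ w → Over w d → ∀ p → bit r (conf w p) ≡ (p <ᵇ σ′ r)
        track w ov p = trans (cong (bit r) (ov p)) (bit-encode d r p)
        enter : ∀ u w → Over w d → parity w ≡ false → hbit u (σ′ r) ≡ false → Compared (bitParity r) u w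
        enter u w ov pw hu = σ′ r , track w ov , trans hu (sym pw)
        leave : ∀ u w → Over w d → parity w ≡ false → Compared (bitParity r) u w → hbit u (σ′ r) ≡ false
        leave u w ov pw (y , tr , hu) = subst (λ y → hbit u y ≡ false)
          (<ᵇ-injective y (σ′ r) (λ p → trans (sym (tr p)) (track w ov p))) (trans hu pw)
        ov-F : Over (F (nodeElement d)) d
        ov-F = over-fixed (nodeElement d) d (conf-node d)
        fixed : (Compared (bitParity r) (wordOf x) (node d) → Compared (bitParity r) (F x) (F (nodeElement d))) ×
                (Compared (bitParity r) (F x) (F (nodeElement d)) → Compared (bitParity r) (wordOf x) (node d))
        fixed = compared-fixed {c} {d} {q} {false}
          (effect-shape q false (subst (λ a → Effect a σ σ′) (sym eq) e)) x over (cong comparisonOf eq)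
        to : hbit (wordOf x) (σ′ r) ≡ false → hbit (F x) (σ′ r) ≡ false
        to h0 = leave (F x) (F (nodeElement d)) ov-F zero-F
          (proj₁ fixed (enter (wordOf x) (node d) (conf-node d) (parity-node d) h0))
        from : hbit (F x) (σ′ r) ≡ false → hbit (wordOf x) (σ′ r) ≡ false
        from h0 = leave (wordOf x) (node d) (conf-node d) (parity-node d)
          (proj₂ fixed (enter (F x) (F (nodeElement d)) ov-F zero-F h0))
      bits : ∀ y → hbit (F x) y ≡ hbit (wordOf x) y
      bits y with children y
      ... | σ′ , refl , e , safe = child σ′ e safe

  -- Back-and-forth systems made of twists.

  τ : ∀ {c e} → Path c e → Element → Element
  τ p (el v nv) = el (twist p v) (flipAt-normal (twistAt p (strip v)) v nv)

  strip-τ : ∀ {c e} (p : Path c e) x → strip (wordOf (τ p x)) ≡ strip (wordOf x)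
  strip-τ p (el v nv) = strip-flipAt (twistAt p (strip v)) v

  -- Flips do not affect the stripped word, so the second twist flips the same number again.
  τ-involutive : ∀ {c e} (p : Path c e) x → τ p (τ p x) ≡ x
  τ-involutive p (el v nv) = element-ext
    (trans (cong (λ w → flipAt (twistAt p w) (twist p v)) (strip-flipAt (twistAt p (strip v)) v))
           (flipAt-involutive (twistAt p (strip v)) v nv))

  Avoids : ∀ {m} → Vec Element m → Config → Set
  Avoids a e = ∀ i → strip (wordOf (lookup a i)) ≢ node e

  module _ {s : S} {σ : Registers} {e : Config} (p : Path (s ∷ [] ∣ σ) e) where

    τ-holds : ∀ i x y → strip (wordOf y) ≢ node e →
              Holds structure i (x ∷ y ∷ []) → Holds structure i (τ p x ∷ τ p y ∷ [])
    τ-holds i x y ne h = related⇒accepts (wordOf (τ p x)) (wordOf (τ p y)) (elem finRelation i)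
      (twist-related p (elem finRelation i) (wordOf x) (wordOf y) ne
        (accepts⇒related (wordOf x) (wordOf y) (elem finRelation i) h))

    τ-reflects : ∀ i x y → strip (wordOf y) ≢ node e →
                 Holds structure i (τ p x ∷ τ p y ∷ []) → Holds structure i (x ∷ y ∷ [])
    τ-reflects i x y ne h = subst₂ (λ x y → Holds structure i (x ∷ y ∷ [])) (τ-involutive p x) (τ-involutive p y)
      (τ-holds i (τ p x) (τ p y) (ne ∘ trans (sym (strip-τ p y))) h)

    τ-QFEquiv : ∀ {m} (a : Vec Element m) → Avoids a e → QFEquiv structure a (Vec.map (τ p) a)
    τ-QFEquiv a av (eqF x y)
      rewrite Vecₚ.lookup-map x (τ p) a | Vecₚ.lookup-map y (τ p) a =
      (λ eq → cong wordOf (cong (τ p) (element-ext {lookup a x} {lookup a y} eq))) ,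
      (λ eq → cong wordOf (trans (sym (τ-involutive p (lookup a x)))
        (trans (cong (τ p) (element-ext {τ p (lookup a x)} {τ p (lookup a y)} eq)) (τ-involutive p (lookup a y)))))
    τ-QFEquiv a av (relF i (x ∷ y ∷ []))
      rewrite Vecₚ.lookup-map x (τ p) a | Vecₚ.lookup-map y (τ p) a =
      τ-holds i (lookup a x) (lookup a y) (av y) , τ-reflects i (lookup a x) (lookup a y) (av y)
    τ-QFEquiv a av (notF ψ) with τ-QFEquiv a av ψ
    ... | f , g = (λ n → n ∘ g) , (λ n → n ∘ f)
    τ-QFEquiv a av (andF ψ χ) with τ-QFEquiv a av ψ | τ-QFEquiv a av χ
    ... | f , g | f′ , g′ = (λ { (x , y) → f x , f′ y }) , (λ { (x , y) → g x , g′ y })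

  -- A step lengthens the history by one and shortens every register by at most one, so the weight
  -- never decreases: after guessing t in register r, all later configurations weigh at least t.
  weight : Fin M → Config → ℕ
  weight r c = length (history c) + registers c r

  effect-weight : ∀ act {σ σ′ : Registers} r → Effect act σ σ′ → σ r ≤ suc (σ′ r)
  effect-weight act {σ} {σ′} r = go act
    where
    equal : σ′ r ≡ σ r → σ r ≤ suc (σ′ r)
    equal eq = ≤-trans (ℕₚ.≤-reflexive (sym eq)) (ℕₚ.n≤1+n _)
    zero! : σ r ≡ 0 → σ r ≤ suc (σ′ r)
    zero! eq = subst (_≤ suc (σ′ r)) (sym eq) z≤n
    go : ∀ act → Effect act σ σ′ → σ r ≤ suc (σ′ r)
    go (inc r′) (eq , same) with r Finₚ.≟ r′
    ... | no ne = equal (same r ne)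
    ... | yes refl = ≤-trans (ℕₚ.n≤1+n _) (≤-trans (ℕₚ.≤-reflexive (sym eq)) (ℕₚ.n≤1+n _))
    go (dec r′) (eq , same) with r Finₚ.≟ r′
    ... | no ne = equal (same r ne)
    ... | yes refl = ℕₚ.≤-reflexive eq
    go (guess r′) (eq , same) with r Finₚ.≟ r′
    ... | no ne = equal (same r ne)
    ... | yes refl = zero! eq
    go (copy _ r′) (eq , _ , same) with r Finₚ.≟ r′
    ... | no ne = equal (same r ne)
    ... | yes refl = zero! eq
    go (test _ _) (_ , same) = equal (same r)
    go stop same = equal (same r)

  step-weight : ∀ {c d} r → Step c d → weight r c ≤ weight r d
  step-weight r (step {q} {h} {σ} {σ′} b _ e) =
    ≤-trans (ℕₚ.+-monoʳ-≤ (suc (length h)) (effect-weight (action q b) r e))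
            (ℕₚ.≤-reflexive (ℕₚ.+-suc (suc (length h)) (σ′ r)))

  path-weight : ∀ {c d} r → Path c d → weight r c ≤ weight r d
  path-weight r ε        = ≤-refl
  path-weight r (st ◅ p) = ≤-trans (step-weight r st) (path-weight r p)

  heavy≢ : ∀ {N} r c {w} → N + N < weight r c → length w ≤ N → w ≢ node c
  heavy≢ r c lt len refl = ℕₚ.<⇒≱ lt (≤-trans (node-length c r) (ℕₚ.+-mono-≤ len len))

  twistAt-heavy : ∀ {N c e} r (p : Path c e) {w} → N + N < weight r c → length w ≤ N → twistAt p w ≡ nothing
  twistAt-heavy r ε lt len = refl
  twistAt-heavy {N} r (_◅_ {c} st p) {w} lt len =
    trans (twistAt-tail st p {w} (heavy≢ {N} r c lt len)) (twistAt-heavy {N} r p (≤-trans lt (step-weight r st)) len)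

  -- `At n c` is to mean that c is about to guess from the point n; T is the register that receives
  -- the padding.
  module _ (R : ℕ → ℕ → Set) (wf : WellFounded R) (T : Fin M) (At : ℕ → Config → Set)
           (s₀ : S) (σ₀ : ℕ → Registers)
           (at-start : ∀ n → At n (s₀ ∷ [] ∣ σ₀ n))
           (safe-start : ∀ n → Safe (s₀ ∷ [] ∣ σ₀ n))
           (descend : ∀ {j n c} → At n c → R j n → ∀ t →
                      ∃ λ d → ∃ λ e → Step c d × t ≤ registers d T × Path d e × At j e) where

    private
      -- One move of the game: x is added to a, and the path is continued beyond its end e. The
      -- entries of a avoid e, and all configurations after e are too heavy to be named by short
      -- words, so the longer path twists a as before while its new end avoids all of `a ++ x`.
      module Extension {n j c e} (p : Path c e) (atn : At n e) (rel : R j n) {m l} (a : Vec Element m)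
                       (x : Vec Element l) (av : Avoids a e) where
        N : ℕ
        N = maxLen (Vec.map wordOf (a ++ x))

        short : ∀ i → length (strip (wordOf (lookup (a ++ x) i))) ≤ N
        short i = ≤-trans (strip-length (wordOf (lookup (a ++ x) i)))
          (subst (λ w → length w ≤ N) (Vecₚ.lookup-map i wordOf (a ++ x)) (lookup-maxLen (Vec.map wordOf (a ++ x)) i))

        -- By `node-length`, a configuration named by a word of length at most N weighs at most N +
        -- N, so this padding exceeds the weight of all of them.
        found : ∃ λ d → ∃ λ e′ → Step e d × suc (N + N) ≤ registers d T × Path d e′ × At j e′
        found = descend atn rel (suc (N + N))

        d e′ : Config
        d = proj₁ found
        e′ = proj₁ (proj₂ found)

        st : Step e d
        st = proj₁ (proj₂ (proj₂ found))

        p₂ : Path d e′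
        p₂ = proj₁ (proj₂ (proj₂ (proj₂ (proj₂ found))))

        at′ : At j e′
        at′ = proj₂ (proj₂ (proj₂ (proj₂ (proj₂ found))))

        heavy : N + N < weight T d
        heavy = ≤-trans (proj₁ (proj₂ (proj₂ (proj₂ found)))) (m≤n+m (registers d T) (length (history d)))

        p′ : Path c e′
        p′ = p ◅◅ (st ◅ p₂)

        avoids : Avoids (a ++ x) e′
        avoids i = heavy≢ {N} T e′ (≤-trans heavy (path-weight T p₂)) (short i)

        agrees : ∀ i → τ p′ (lookup a i) ≡ τ p (lookup a i)
        agrees i = element-ext (cong (λ m → flipAt m v) (twistAt-◅◅ p (st ◅ p₂)
          (trans (twistAt-tail st p₂ (av i)) (twistAt-heavy {N} T p₂ heavy len))))
          where
          v : Word
          v = wordOf (lookup a i)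
          len : length (strip v) ≤ N
          len = subst (λ y → length (strip (wordOf y)) ≤ N) (Vecₚ.lookup-++ˡ a x i) (short (i ↑ˡ _))

        images : Vec.map (τ p′) (a ++ x) ≡ Vec.map (τ p) a ++ Vec.map (τ p′) x
        images = trans (Vecₚ.map-++ (τ p′) a x) (cong (_++ Vec.map (τ p′) x) (map-cong-lookup a agrees))

    -- Induction on accessibility. Each move is answered by the image under the twist along the
    -- continued path; this twist is its own inverse, so the same answer serves in both directions.
    equivalent : ∀ {n} (ac : Acc R n) {x e} (p : Path (s₀ ∷ [] ∣ σ₀ x) e) → At n e →
                 ∀ {m} (a : Vec Element m) → Avoids a e → BF structure R n ac a (Vec.map (τ p) a)
    equivalent (acc rs) p atn a av = τ-QFEquiv p a av , forth , back
      where
      forth : ∀ {j} (r : R j _) l (c : Vec Element l) →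
              ∃ λ d → BF structure R j (rs r) (a ++ c) (Vec.map (τ p) a ++ d)
      forth {j} r l c = Vec.map (τ p′) c ,
        subst (BF structure R j (rs r) (a ++ c)) images (equivalent (rs r) p′ at′ (a ++ c) avoids)
        where open Extension p atn r a c av
      back : ∀ {j} (r : R j _) l (d : Vec Element l) →
             ∃ λ c → BF structure R j (rs r) (a ++ c) (Vec.map (τ p) a ++ d)
      back {j} r l y = Vec.map (τ p′) y ,
        subst (BF structure R j (rs r) (a ++ Vec.map (τ p′) y)) eq
          (equivalent (rs r) p′ at′ (a ++ Vec.map (τ p′) y) avoids′)
        where
        open Extension p atn r a y av
        -- The extension was chosen for `a ++ y`; since twists keep stripped words, the image of y
        -- avoids the new end too.
        avoids′ : Avoids (a ++ Vec.map (τ p′) y) e′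
        avoids′ = lookup-++-all {P = λ z → strip (wordOf z) ≢ node e′} a
          (λ i → subst (λ z → strip (wordOf z) ≢ node e′) (Vecₚ.lookup-++ˡ a y i) (avoids (i ↑ˡ _)))
          (λ i → subst (λ z → strip (wordOf z) ≢ node e′) (sym (Vecₚ.lookup-map i (τ p′) y))
            (subst (_≢ node e′) (sym (strip-τ p′ (lookup y i)))
              (subst (λ z → strip (wordOf z) ≢ node e′) (Vecₚ.lookup-++ʳ a y i) (avoids (_ ↑ʳ i)))))
        eq : Vec.map (τ p′) (a ++ Vec.map (τ p′) y) ≡ Vec.map (τ p) a ++ y
        eq = trans (Vecₚ.map-++ (τ p′) a (Vec.map (τ p′) y))
          (cong₂ _++_ (map-cong-lookup a agrees)
            (trans (sym (Vecₚ.map-∘ (τ p′) (τ p′) y)) (trans (Vecₚ.map-cong (τ-involutive p′) y) (Vecₚ.map-id y))))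

    -- The same one-element tuple serves for every j. The twist along a path from the start at n to
    -- a configuration at j makes its parity odd, whereas automorphisms keep it even by
    -- `parity-fixed`.
    scottRank : ScottRankAtLeastHeight structure R wf
    scottRank n = 1 , a , notDetermined
      where
      c : Config
      c = s₀ ∷ [] ∣ σ₀ n
      a : Vec Element 1
      a = nodeElement c ∷ []
      notDetermined : ∀ {j} → R j n → ¬ (∀ b → BF structure R j (wf j) a b → Iso structure a b)
      notDetermined {j} r det = clash (det (Vec.map (τ p) a) (equivalent (wf j) p at′ a avoids))
        where
        N : ℕ
        N = length (node c)
        found : ∃ λ d → ∃ λ e → Step c d × suc (N + N) ≤ registers d T × Path d e × At j e
        found = descend (at-start n) r (suc (N + N))
        d e : Config
        d = proj₁ found
        e = proj₁ (proj₂ found)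
        st : Step c d
        st = proj₁ (proj₂ (proj₂ found))
        p₂ : Path d e
        p₂ = proj₁ (proj₂ (proj₂ (proj₂ (proj₂ found))))
        p : Path c e
        p = st ◅ p₂
        at′ : At j e
        at′ = proj₂ (proj₂ (proj₂ (proj₂ (proj₂ found))))
        avoids : Avoids a e
        avoids zero = heavy≢ {N} T e
          (≤-trans (≤-trans (proj₁ (proj₂ (proj₂ (proj₂ found)))) (m≤n+m (registers d T) (length (history d))))
                   (path-weight T p₂))
          (strip-length (node c))
        clash : Iso structure a (Vec.map (τ p) a) → ⊥
        clash (f , _ , _ , _ , pres , moves) = false≢true (begin
          false                                        ≡⟨ parity-node c ⟨
          parity (node c)                              ≡⟨ parity-fixed f pres (safe-start n) (nodeElement c) (conf-node c) ⟨
          parity (wordOf (f (nodeElement c)))          ≡⟨ cong parity (moves zero) ⟩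
          parity (twist p (node c))                    ≡⟨ cong (λ m → parity (flipAt m (node c)))
                                                            (twistAt-head st p₂ (over⇒strip (node c) c (conf-node c))) ⟩
          parity (flip (flipped st) (node c))          ≡⟨ parity-flip (flipped st) (node c) ⟩
          not (parity (node c))                        ≡⟨ cong not (parity-node c) ⟩
          true                                         ∎)
          where
          open ≡-Reasoning
          false≢true : false ≢ true
          false≢true ()

-- While programs.

Store : Set
Store = ℕ → ℕ

_[_↦_] : Store → ℕ → ℕ → Store
(σ [ r ↦ v ]) x with x ℕₚ.≟ r
... | yes _ = v
... | no  _ = σ x

↦-same : ∀ σ r v → (σ [ r ↦ v ]) r ≡ v
↦-same σ r v with r ℕₚ.≟ r
... | yes _ = refl
... | no ne = ⊥-elim (ne refl)

↦-other : ∀ σ r v {x} → x ≢ r → (σ [ r ↦ v ]) x ≡ σ x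
↦-other σ r v {x} ne with x ℕₚ.≟ r
... | yes eq = ⊥-elim (ne eq)
... | no _ = refl

infixr 5 _⨾_
data Cmd : Set where
  add1 sub1 : ℕ → Cmd
  dup       : ℕ → ℕ → Cmd
  _⨾_       : Cmd → Cmd → Cmd
  while     : ℕ → Cmd → Cmd

data Exec : Cmd → Store → Store → Set where
  add1   : ∀ {r σ} → Exec (add1 r) σ (σ [ r ↦ suc (σ r) ])
  sub1   : ∀ {r σ n} → σ r ≡ suc n → Exec (sub1 r) σ (σ [ r ↦ n ])
  dup    : ∀ {r r′ σ} → σ r′ ≡ 0 → Exec (dup r r′) σ (σ [ r′ ↦ σ r ])
  _⨾_    : ∀ {c c′ σ σ′ σ″} → Exec c σ σ′ → Exec c′ σ′ σ″ → Exec (c ⨾ c′) σ σ″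
  while0 : ∀ {r c σ} → σ r ≡ 0 → Exec (while r c) σ σ
  whileS : ∀ {r c σ σ′ σ″ n} → σ r ≡ suc n → Exec c σ σ′ → Exec (while r c) σ′ σ″ → Exec (while r c) σ σ″

clear : ℕ → Cmd
clear r = while r (sub1 r)

-- `dup` runs only with an empty target, hence the `clear`.
set : ℕ → ℕ → Cmd
set a b = clear b ⨾ dup a b

Assigns : Cmd → ℕ → ℕ → Store → Set
Assigns c r v σ = ∃ λ σ′ → Exec c σ σ′ × σ′ r ≡ v × (∀ x → x ≢ r → σ′ x ≡ σ x)

clear-assigns : ∀ n r σ → σ r ≡ n → Assigns (clear r) r 0 σ
clear-assigns zero    r σ eq = σ , while0 eq , eq , λ _ _ → refl
clear-assigns (suc n) r σ eq with clear-assigns n r (σ [ r ↦ n ]) (↦-same σ r n)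
... | σ′ , ex , z , same = σ′ , whileS eq (sub1 eq) ex , z , λ x ne → trans (same x ne) (↦-other σ r n ne)

set-assigns : ∀ a b σ → a ≢ b → Assigns (set a b) b (σ a) σ
set-assigns a b σ ne with clear-assigns (σ b) b σ refl
... | σ′ , ex , z , same = σ′ [ b ↦ σ′ a ] , (ex ⨾ dup z) , trans (↦-same σ′ b _) (same a ne) ,
  λ x ne′ → trans (↦-other σ′ b _ ne′) (same x ne′)

-- Compilation of recursive functions to while programs.

range : ℕ → ∀ m → Vec ℕ m
range e zero    = []
range e (suc m) = e ∷ range (suc e) m

-- compile f ins out d reads the registers ins, writes the result to register out, and may use
-- every register from d upwards as scratch space.
mutual
  compile : ∀ {n} → PR n → Vec ℕ n → ℕ → ℕ → Cmd
  compile zeroF       ins        out d = clear out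
  compile succF       (r ∷ [])   out d = set r out ⨾ add1 out
  compile (projF i)   ins        out d = set (lookup ins i) out
  compile (compF {m} g hs) ins   out d = compileAll hs ins d (d + m) (compile g (range d m) out (d + m))
  compile (precF g h) (r ∷ ins)  out d = precInit g ins r d ⨾ precLoop h ins d ⨾ set (1 + d) out
  compile (muF f)     ins        out d =
    clear d ⨾ compile f (d ∷ ins) (1 + d) (2 + d) ⨾ muLoop f ins d ⨾ set d out

  -- The results go to the registers from e on, with scratch space from d on. Passing the
  -- continuation `rest` avoids the need for an empty command.
  compileAll : ∀ {n m} → Vec (PR n) m → Vec ℕ n → ℕ → ℕ → Cmd → Cmd
  compileAll []       ins e d rest = rest
  compileAll (h ∷ hs) ins e d rest = compile h ins e d ⨾ compileAll hs ins (suc e) d rest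

  -- Registers d, 1 + d, 2 + d and 3 + d hold the round counter, the value so far, the next value
  -- and the number of rounds left.
  precInit : ∀ {n} → PR n → Vec ℕ n → ℕ → ℕ → Cmd
  precInit g ins r d = compile g ins (1 + d) (4 + d) ⨾ clear d ⨾ set r (3 + d)

  precLoop : ∀ {n} → PR (suc (suc n)) → Vec ℕ n → ℕ → Cmd
  precLoop h ins d =
    while (3 + d) (sub1 (3 + d) ⨾ compile h (d ∷ 1 + d ∷ ins) (2 + d) (4 + d) ⨾ set (2 + d) (1 + d) ⨾ add1 d)

  -- Register d holds the candidate and 1 + d the value of f at it.
  muLoop : ∀ {n} → PR (suc n) → Vec ℕ n → ℕ → Cmd
  muLoop f ins d = while (1 + d) (add1 d ⨾ compile f (d ∷ ins) (1 + d) (2 + d))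

Inputs : ∀ {n} → Vec ℕ n → Vec ℕ n → ℕ → Store → Set
Inputs ins xs d σ = ∀ i → lookup ins i < d × σ (lookup ins i) ≡ lookup xs i

Agree : ℕ → Store → Store → Set
Agree d σ σ′ = ∀ x → x < d → σ′ x ≡ σ x

inputs-agree : ∀ {n} (ins xs : Vec ℕ n) {d σ σ′} → Agree d σ σ′ → Inputs ins xs d σ → Inputs ins xs d σ′
inputs-agree ins xs ag inp i = proj₁ (inp i) , trans (ag _ (proj₁ (inp i))) (proj₂ (inp i))

inputs-weaken : ∀ {n} (ins xs : Vec ℕ n) σ {d d′} → d ≤ d′ → Inputs ins xs d σ → Inputs ins xs d′ σ
inputs-weaken ins xs σ d≤ inp i = ≤-trans (proj₁ (inp i)) d≤ , proj₂ (inp i)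

Computes : Cmd → ℕ → ℕ → ℕ → Store → Set
Computes c out d v σ = ∃ λ σ′ → Exec c σ σ′ × σ′ out ≡ v × (∀ x → x < d → x ≢ out → σ′ x ≡ σ x)

assigns⇒computes : ∀ {c r d v σ} → Assigns c r v σ → Computes c r d v σ
assigns⇒computes (σ′ , ex , eq , same) = σ′ , ex , eq , λ x _ → same x

range-bound : ∀ e m i → lookup (range e m) i < e + m
range-bound e (suc m) zero    = ℕₚ.m<m+n e (s≤s z≤n)
range-bound e (suc m) (suc i) = subst (lookup (range (suc e) m) i <_) (sym (ℕₚ.+-suc e m)) (range-bound (suc e) m i)

range-from : ∀ e m i → e ≤ lookup (range e m) i
range-from e (suc m) zero    = ≤-refl
range-from e (suc m) (suc i) = ≤-trans (ℕₚ.n≤1+n e) (range-from (suc e) m i)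

private
  below≢ : ∀ {x d} k → x < d → x ≢ k + d
  below≢ {x} {d} k lt = ℕₚ.<⇒≢ (≤-trans lt (m≤n+m d k))

  offset≢ : ∀ {j k} d → j ≢ k → j + d ≢ k + d
  offset≢ d ne eq = ne (ℕₚ.+-cancelʳ-≡ d _ _ eq)

  offset< : ∀ {j k} d → j < k → j + d < k + d
  offset< d = ℕₚ.+-monoˡ-< d

  mu-inputs : ∀ {n} (ins : Vec ℕ n) {xs d σ y} → Inputs ins xs d σ → σ d ≡ y → Inputs (d ∷ ins) (y ∷ xs) (2 + d) σ
  mu-inputs ins {d = d} inp eq zero    = offset< {0} {2} d (s≤s z≤n) , eq
  mu-inputs ins {d = d} inp eq (suc i) = ≤-trans (proj₁ (inp i)) (m≤n+m d 2) , proj₂ (inp i)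

  mu-distinct : ∀ {n} (ins xs : Vec ℕ n) σ {d} → Inputs ins xs d σ → ∀ i → lookup (d ∷ ins) i ≢ 1 + d
  mu-distinct ins xs σ {d} inp zero    = offset≢ {0} {1} d λ ()
  mu-distinct ins xs σ {d} inp (suc i) = below≢ 1 (proj₁ (inp i))

mutual
  -- Induction on the evaluation. Nothing is assumed about the scratch registers, because each is
  -- cleared or set before it is read.
  compile-computes : ∀ {n} {f : PR n} {xs v} → Eval f xs v → ∀ ins out d σ → Inputs ins xs d σ →
                     (∀ i → lookup ins i ≢ out) → out < d → Computes (compile f ins out d) out d v σ
  compile-computes evZero ins out d σ inp ne o<d = assigns⇒computes (clear-assigns (σ out) out σ refl)
  compile-computes evSucc (r ∷ []) out d σ inp ne o<d with set-assigns r out σ (ne zero)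
  ... | σ′ , ex , eq , same = σ′ [ out ↦ suc (σ′ out) ] , (ex ⨾ add1) ,
    trans (↦-same σ′ out _) (cong suc (trans eq (proj₂ (inp zero)))) ,
    λ x _ ne′ → trans (↦-other σ′ out _ ne′) (same x ne′)
  compile-computes {f = projF i} (evProj {xs = xs}) ins out d σ inp ne o<d
    with set-assigns (lookup ins i) out σ (ne i)
  ... | σ′ , ex , eq , same = σ′ , ex , trans eq (proj₂ (inp i)) , λ x _ → same x
  compile-computes {f = compF {m} g hs} (evComp evs ev) ins out d σ inp ne o<d
    with compileAll-computes evs ins d (d + m) σ inp ≤-refl
  ... | σ₁ , run , ag , vals
    with compile-computes ev (range d m) out (d + m) σ₁
           (λ i → range-bound d m i , vals i)
           (λ i → ℕₚ.>⇒≢ (≤-trans o<d (range-from d m i)))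
           (≤-trans o<d (m≤m+n d m))
  ... | σ₂ , ex , eq , same = σ₂ , run ex , eq ,
    λ x lt ne′ → trans (same x (≤-trans lt (m≤m+n d m)) ne′) (ag x lt)
  compile-computes {f = precF g h} {xs = y ∷ xs} ev (r ∷ ins) out d σ inp ne o<d
    with prec-computes ev ins r d σ 0 (inp ∘ suc) (proj₁ (inp zero))
           (trans (proj₂ (inp zero)) (sym (ℕₚ.+-identityʳ y)))
  ... | σ₁ , σ₂ , init , reach , _ , acc≡ , rem≡ , ag
    with set-assigns (1 + d) out σ₂ (below≢ 1 o<d ∘ sym)
  ... | σ₃ , ex , eq , same = σ₃ , (init ⨾ reach (while0 rem≡) ⨾ ex) , trans eq acc≡ ,
    λ x lt ne′ → trans (same x ne′) (ag x lt)
  compile-computes {f = muF f} {xs} (evMu mu) ins out d σ inp ne o<d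
    with clear-assigns (σ d) d σ refl
  ... | σ₁ , ex₁ , zero≡ , same₁
    with mu-computes mu ins d σ₁ (inputs-agree ins xs (λ x lt → same₁ x (ℕₚ.<⇒≢ lt)) inp) zero≡
  ... | σ₂ , σ₃ , ex₂ , ex₃ , eq , ag with set-assigns d out σ₃ (ℕₚ.>⇒≢ o<d)
  ... | σ₄ , ex₄ , eq′ , same₄ = σ₄ , (ex₁ ⨾ ex₂ ⨾ ex₃ ⨾ ex₄) , trans eq′ eq ,
    λ x lt ne′ → trans (same₄ x ne′) (trans (ag x lt) (same₁ x (ℕₚ.<⇒≢ lt)))

  compileAll-computes : ∀ {n m} {hs : Vec (PR n) m} {xs ys} → EvalAll hs xs ys → ∀ ins e d σ →
    Inputs ins xs e σ → e + m ≤ d →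
    ∃ λ σ′ → (∀ {rest σ″} → Exec rest σ′ σ″ → Exec (compileAll hs ins e d rest) σ σ″) ×
             Agree e σ σ′ × (∀ i → σ′ (lookup (range e m) i) ≡ lookup ys i)
  compileAll-computes [] ins e d σ inp le = σ , id , (λ _ _ → refl) , λ ()
  compileAll-computes {m = suc m} {xs = xs} (ev ∷ evs) ins e d σ inp le
    with compile-computes ev ins e d σ
           (inputs-weaken ins xs σ (≤-trans (m≤m+n e (suc m)) le) inp)
           (λ i → ℕₚ.<⇒≢ (proj₁ (inp i))) (≤-trans (ℕₚ.m<m+n e (s≤s z≤n)) le)
  ... | σ₁ , ex , eq , same
    with compileAll-computes evs ins (suc e) d σ₁
           (inputs-weaken ins xs σ₁ (ℕₚ.n≤1+n e) (inputs-agree ins xs agree₁ inp))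
           (subst (_≤ d) (ℕₚ.+-suc e m) le)
    where
    agree₁ : Agree e σ σ₁
    agree₁ x lt = same x (≤-trans lt (≤-trans (m≤m+n e (suc m)) le)) (ℕₚ.<⇒≢ lt)
  ... | σ₂ , run , ag , vals = σ₂ , (λ rest → ex ⨾ run rest) ,
    (λ x lt → trans (ag x (ℕₚ.m<n⇒m<1+n lt)) (same x (≤-trans lt (≤-trans (m≤m+n e (suc m)) le)) (ℕₚ.<⇒≢ lt))) ,
    λ { zero → trans (ag e ≤-refl) eq ; (suc i) → vals i }

  -- In an evaluation the last round is outermost, but the loop runs the first round first. Hence
  -- the claim describes the loop after y rounds with z left, and completes any run from there to a
  -- run of the whole loop. With z equal to 0 the loop is over.
  prec-computes : ∀ {n} {g : PR n} {h y xs u} → Eval (precF g h) (y ∷ xs) u → ∀ ins r d σ z →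
    Inputs ins xs d σ → r < d → σ r ≡ y + z →
    ∃ λ σ₁ → ∃ λ σ₂ → Exec (precInit g ins r d) σ σ₁ ×
      (∀ {σ₃} → Exec (precLoop h ins d) σ₂ σ₃ → Exec (precLoop h ins d) σ₁ σ₃) ×
      σ₂ d ≡ y × σ₂ (1 + d) ≡ u × σ₂ (3 + d) ≡ z × Agree d σ σ₂
  prec-computes {xs = xs} (evPrec0 ev) ins r d σ z inp r<d eq
    with compile-computes ev ins (1 + d) (4 + d) σ (inputs-weaken ins xs σ (m≤n+m d 4) inp)
           (λ i → below≢ 1 (proj₁ (inp i))) (offset< d (s≤s (s≤s z≤n)))
  ... | σ₁ , ex₁ , acc≡ , same₁ with clear-assigns (σ₁ d) d σ₁ refl
  ... | σ₂ , ex₂ , k≡ , same₂ with set-assigns r (3 + d) σ₂ (below≢ 3 r<d)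
  ... | σ₃ , ex₃ , rem≡ , same₃ = σ₃ , σ₃ , (ex₁ ⨾ ex₂ ⨾ ex₃) , id ,
    trans (same₃ d (offset≢ {0} {3} d λ ())) k≡ ,
    trans (same₃ (1 + d) (offset≢ {1} {3} d λ ())) (trans (same₂ (1 + d) (offset≢ {1} {0} d λ ())) acc≡) ,
    trans rem≡ (trans (agree₂ r r<d) eq) ,
    λ x lt → trans (same₃ x (below≢ 3 lt)) (agree₂ x lt)
    where
    agree₂ : Agree d σ σ₂
    agree₂ x lt = trans (same₂ x (below≢ 0 lt)) (same₁ x (≤-trans lt (m≤n+m d 4)) (below≢ 1 lt))
  prec-computes {h = h} {suc y} {xs} {v} (evPrecS {u = u} ev evh) ins r d σ z inp r<d eq
    with prec-computes ev ins r d σ (suc z) inp r<d (trans eq (sym (ℕₚ.+-suc y z)))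
  ... | σ₁ , σ₂ , init , reach , k≡ , acc≡ , rem≡ , ag
    with compile-computes evh (d ∷ 1 + d ∷ ins) (2 + d) (4 + d) (σ₂ [ 3 + d ↦ z ]) inputs distinct
           (offset< d (s≤s (s≤s (s≤s z≤n))))
    where
    other : ∀ x → x ≢ 3 + d → (σ₂ [ 3 + d ↦ z ]) x ≡ σ₂ x
    other x ne = ↦-other σ₂ (3 + d) z ne
    inputs : Inputs (d ∷ 1 + d ∷ ins) (y ∷ u ∷ xs) (4 + d) (σ₂ [ 3 + d ↦ z ])
    inputs zero          = offset< {0} {4} d (s≤s z≤n) , trans (other d (offset≢ {0} {3} d λ ())) k≡
    inputs (suc zero)    = offset< {1} {4} d (s≤s (s≤s z≤n)) , trans (other (1 + d) (offset≢ {1} {3} d λ ())) acc≡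
    inputs (suc (suc i)) = ≤-trans (proj₁ (inp i)) (m≤n+m d 4) ,
      trans (other _ (below≢ 3 (proj₁ (inp i)))) (trans (ag _ (proj₁ (inp i))) (proj₂ (inp i)))
    distinct : ∀ i → lookup (d ∷ 1 + d ∷ ins) i ≢ 2 + d
    distinct zero          = offset≢ {0} {2} d λ ()
    distinct (suc zero)    = offset≢ {1} {2} d λ ()
    distinct (suc (suc i)) = below≢ 2 (proj₁ (inp i))
  ... | σ₃ , ex₃ , new≡ , same₃ with set-assigns (2 + d) (1 + d) σ₃ (offset≢ {2} {1} d λ ())
  ... | σ₄ , ex₄ , acc≡′ , same₄ = σ₁ , σ₅ , init ,
    (λ ex → reach (whileS rem≡ (sub1 rem≡ ⨾ ex₃ ⨾ ex₄ ⨾ add1) ex)) ,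
    trans (↦-same σ₄ d _) (cong suc (trans (same₄ d (offset≢ {0} {1} d λ ()))
      (trans (below d (offset< {0} {4} d (s≤s z≤n)) (offset≢ {0} {2} d λ ()) (offset≢ {0} {3} d λ ())) k≡))) ,
    trans (↦-other σ₄ d _ (offset≢ {1} {0} d λ ())) (trans acc≡′ new≡) ,
    trans (↦-other σ₄ d _ (offset≢ {3} {0} d λ ())) (trans (same₄ (3 + d) (offset≢ {3} {1} d λ ()))
      (trans (same₃ (3 + d) ≤-refl (offset≢ {3} {2} d λ ())) (↦-same σ₂ (3 + d) z))) ,
    λ x lt → trans (↦-other σ₄ d _ (below≢ 0 lt)) (trans (same₄ x (below≢ 1 lt))
      (trans (below x (≤-trans lt (m≤n+m d 4)) (below≢ 2 lt) (below≢ 3 lt)) (ag x lt)))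
    where
    σ₅ : Store
    σ₅ = σ₄ [ d ↦ suc (σ₄ d) ]
    below : ∀ x → x < 4 + d → x ≢ 2 + d → x ≢ 3 + d → σ₃ x ≡ σ₂ x
    below x lt ne₂ ne₃ = trans (same₃ x lt ne₂) (↦-other σ₂ (3 + d) z ne₃)

  -- The loop tests a value computed before it is entered, so the claim begins with the evaluation
  -- of f at the candidate y.
  mu-computes : ∀ {n} {f : PR (suc n)} {xs y v} → MuFrom f xs y v → ∀ ins d σ → Inputs ins xs d σ → σ d ≡ y →
    ∃ λ σ₁ → ∃ λ σ₂ → Exec (compile f (d ∷ ins) (1 + d) (2 + d)) σ σ₁ × Exec (muLoop f ins d) σ₁ σ₂ ×
      σ₂ d ≡ v × Agree d σ σ₂
  mu-computes {xs = xs} (muHere ev) ins d σ inp eq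
    with compile-computes ev (d ∷ ins) (1 + d) (2 + d) σ (mu-inputs ins inp eq) (mu-distinct ins xs σ inp) ≤-refl
  ... | σ₁ , ex , val≡ , same = σ₁ , σ₁ , ex , while0 val≡ ,
    trans (same d (offset< {0} {2} d (s≤s z≤n)) (offset≢ {0} {1} d λ ())) eq ,
    λ x lt → same x (≤-trans lt (m≤n+m d 2)) (below≢ 1 lt)
  mu-computes {xs = xs} (muNext ev mu) ins d σ inp eq
    with compile-computes ev (d ∷ ins) (1 + d) (2 + d) σ (mu-inputs ins inp eq) (mu-distinct ins xs σ inp) ≤-refl
  ... | σ₁ , ex , val≡ , same
    with mu-computes mu ins d (σ₁ [ d ↦ suc (σ₁ d) ]) (inputs-agree ins xs agree₁ inp)
           (trans (↦-same σ₁ d _) (cong suc (trans (same d (offset< {0} {2} d (s≤s z≤n)) (offset≢ {0} {1} d λ ())) eq)))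
    where
    agree₁ : Agree d σ (σ₁ [ d ↦ suc (σ₁ d) ])
    agree₁ x lt = trans (↦-other σ₁ d _ (below≢ 0 lt)) (same x (≤-trans lt (m≤n+m d 2)) (below≢ 1 lt))
  ... | σ₂ , σ₃ , ex₂ , ex₃ , eq′ , ag = σ₁ , σ₃ , ex , whileS val≡ (add1 ⨾ ex₂) ex₃ , eq′ ,
    λ x lt → trans (ag x lt) (trans (↦-other σ₁ d _ (below≢ 0 lt)) (same x (≤-trans lt (m≤n+m d 2)) (below≢ 1 lt)))

-- Translation of while programs to machines with finitely many registers.

Pos : Cmd → Set
Pos (add1 _)    = ⊤
Pos (sub1 _)    = ⊤
Pos (dup _ _)   = ⊤
Pos (c ⨾ c′)    = Pos c ⊎ Pos c′
Pos (while _ c) = ⊤ ⊎ Pos c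

finite-Pos : ∀ c → Finite (Pos c)
finite-Pos (add1 _)    = finite-⊤
finite-Pos (sub1 _)    = finite-⊤
finite-Pos (dup _ _)   = finite-⊤
finite-Pos (c ⨾ c′)    = finite-⊎ (finite-Pos c) (finite-Pos c′)
finite-Pos (while _ c) = finite-⊎ finite-⊤ (finite-Pos c)

entry : ∀ c → Pos c
entry (add1 _)    = tt
entry (sub1 _)    = tt
entry (dup _ _)   = tt
entry (c ⨾ _)     = inj₁ (entry c)
entry (while _ _) = inj₁ tt

-- `emb` places the control points of c among the states of a larger program, and `exit` is the
-- state in which that program continues after c.
code : ∀ {S} c → (Pos c → S) → S → Pos c → Instr S ℕ
code (add1 r)    emb exit _        = exec (inc r) exit
code (sub1 r)    emb exit _        = exec (dec r) exit
code (dup a b)   emb exit _        = exec (copy a b) exit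
code (c ⨾ c′)    emb exit (inj₁ p) = code c (emb ∘ inj₁) (emb (inj₂ (entry c′))) p
code (c ⨾ c′)    emb exit (inj₂ p) = code c′ (emb ∘ inj₂) exit p
code (while r c) emb exit (inj₁ _) = jump r exit (emb (inj₂ (entry c)))
code (while r c) emb exit (inj₂ p) = code c (emb ∘ inj₂) (emb (inj₁ tt)) p

mapAction : ∀ {R R′ : Set} → (R → R′) → Action R → Action R′
mapAction f (inc r)    = inc (f r)
mapAction f (dec r)    = dec (f r)
mapAction f (guess r)  = guess (f r)
mapAction f (copy r s) = copy (f r) (f s)
mapAction f (test r b) = test (f r) b
mapAction f stop       = stop

mapInstr : ∀ {S R R′ : Set} → (R → R′) → Instr S R → Instr S R′
mapInstr f (exec a s)     = exec (mapAction f a) s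
mapInstr f (jump r s₀ s₁) = jump (f r) s₀ s₁

rule-map : ∀ {S R R′ : Set} (f : R → R′) (i : Instr S R) b →
           rule (mapInstr f i) b ≡ (mapAction f (proj₁ (rule i b)) , proj₂ (rule i b))
rule-map f (exec a s)     b = refl
rule-map f (jump r s₀ s₁) b = refl

Fits : ℕ → Action ℕ → Set
Fits m (inc r)    = r < m
Fits m (dec r)    = r < m
Fits m (guess r)  = r < m
Fits m (copy r s) = r < m × s < m
Fits m (test r b) = r < m
Fits m stop       = ⊤

registerBound : Action ℕ → ℕ
registerBound (inc r)    = suc r
registerBound (dec r)    = suc r
registerBound (guess r)  = suc r
registerBound (copy r s) = suc r ⊔ suc s
registerBound (test r b) = suc r
registerBound stop       = 0

registerBound-fits : ∀ a {m} → registerBound a ≤ m → Fits m a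
registerBound-fits (inc r)    le = le
registerBound-fits (dec r)    le = le
registerBound-fits (guess r)  le = le
registerBound-fits (copy r s) le = ≤-trans (m≤m⊔n (suc r) (suc s)) le , ≤-trans (m≤n⊔m (suc r) (suc s)) le
registerBound-fits (test r b) le = le
registerBound-fits stop       le = tt

module Assembled {S : Set} (finS : Finite S) (progℕ : S → Instr S ℕ) where

  private
    boundAt : Bool → Fin (size finS) → ℕ
    boundAt b i = registerBound (proj₁ (rule (progℕ (elem finS i)) b))

  abstract
    M : ℕ
    -- A successor, so that `clamp` always has register 0 to fall back on.
    M = suc (maximum (boundAt false) ⊔ maximum (boundAt true))

    fits : ∀ q b → Fits M (proj₁ (rule (progℕ q) b))
    fits q b = registerBound-fits _ (≤-trans (bounded b)
      (≤-trans (select b) (ℕₚ.n≤1+n _)))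
      where
      bounded : ∀ b → registerBound (proj₁ (rule (progℕ q) b)) ≤ maximum (boundAt b)
      bounded b = subst (λ q′ → registerBound (proj₁ (rule (progℕ q′) b)) ≤ maximum (boundAt b))
                        (elem-index finS q) (≤-maximum (boundAt b) (index finS q))
      select : ∀ b → maximum (boundAt b) ≤ maximum (boundAt false) ⊔ maximum (boundAt true)
      select false = m≤m⊔n (maximum (boundAt false)) (maximum (boundAt true))
      select true  = m≤n⊔m (maximum (boundAt false)) (maximum (boundAt true))

    -- Registers outside the bound never occur in the program.
    clamp : ℕ → Fin M
    clamp r with r <? M
    ... | yes r<M = fromℕ< r<M
    ... | no  _   = zero

    toℕ-clamp : ∀ {r} → r < M → toℕ (clamp r) ≡ r
    toℕ-clamp {r} r<M with r <? M
    ... | yes lt = Finₚ.toℕ-fromℕ< lt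
    ... | no ¬lt = ⊥-elim (¬lt r<M)

  prog : S → Instr S (Fin M)
  prog q = mapInstr clamp (progℕ q)

  open ScottRank finS M prog public

  ⌊_⌋ : Store → Registers
  ⌊ σ ⌋ i = σ (toℕ i)

  effect-clamp : ∀ a {σ σ′} → Fits M a → Effect a σ σ′ → Effect (mapAction clamp a) ⌊ σ ⌋ ⌊ σ′ ⌋
  effect-clamp a {σ} {σ′} = go a
    where
    others : ∀ {r} → r < M → (∀ x → x ≢ r → σ′ x ≡ σ x) → ∀ i → i ≢ clamp r → ⌊ σ′ ⌋ i ≡ ⌊ σ ⌋ i
    others lt same i ne = same (toℕ i) (λ eq → ne (Finₚ.toℕ-injective (trans eq (sym (toℕ-clamp lt)))))
    go : ∀ a → Fits M a → Effect a σ σ′ → Effect (mapAction clamp a) ⌊ σ ⌋ ⌊ σ′ ⌋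
    go (inc r) lt (eq , same) =
      subst (λ x → σ′ x ≡ suc (σ x)) (sym (toℕ-clamp lt)) eq , others lt same
    go (dec r) lt (eq , same) =
      subst (λ x → σ x ≡ suc (σ′ x)) (sym (toℕ-clamp lt)) eq , others lt same
    go (guess r) lt (eq , same) =
      subst (λ x → σ x ≡ 0) (sym (toℕ-clamp lt)) eq , others lt same
    go (copy r s) (lt , lt′) (eq , eq′ , same) =
      subst (λ x → σ x ≡ 0) (sym (toℕ-clamp lt′)) eq ,
      subst₂ (λ x y → σ′ x ≡ σ y) (sym (toℕ-clamp lt′)) (sym (toℕ-clamp lt)) eq′ , others lt′ same
    go (test r b) lt (eq , same) =
      subst (λ x → (0 <ᵇ σ x) ≡ b) (sym (toℕ-clamp lt)) eq , λ i → same (toℕ i)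
    go stop _ same i = same (toℕ i)

  -- A path together with the transfer of safety back along it: the path serves the twists, the
  -- transfer serves the induction on parities.
  Run : Config → Config → Set
  Run c d = Path c d × (Safe d → Safe c)

  _∙_ : ∀ {c d e} → Run c d → Run d e → Run c e
  (p , s) ∙ (p′ , s′) = p ◅◅ p′ , s ∘ s′

  -- The condition on `comparisonOf` singles out the deterministic actions, those that neither guess
  -- nor stop.
  run-rule : ∀ q b {a s h σ σ′} → rule (progℕ q) b ≡ (a , s) → comparisonOf (mapAction clamp a) ≡ sameParity →
             Effect a σ σ′ → Run (q ∷ h ∣ ⌊ σ ⌋) (s ∷ q ∷ h ∣ ⌊ σ′ ⌋)
  run-rule q b {a} {s} {h} {σ} {σ′} eq cmp e =
    subst (λ s → Run (q ∷ h ∣ ⌊ σ ⌋) (s ∷ q ∷ h ∣ ⌊ σ′ ⌋)) (cong proj₂ eq′)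
      ((step b moves effect ◅ ε) , safe-step b cmp′ effect)
    where
    eq′ : rule (prog q) b ≡ (mapAction clamp a , s)
    eq′ = trans (rule-map clamp (progℕ q) b) (cong (λ x → mapAction clamp (proj₁ x) , proj₂ x) eq)
    effect : Effect (action q b) ⌊ σ ⌋ ⌊ σ′ ⌋
    effect = subst (λ x → Effect x ⌊ σ ⌋ ⌊ σ′ ⌋) (cong proj₁ (sym eq′))
      (effect-clamp a (subst (Fits M) (cong proj₁ eq) (fits q b)) e)
    cmp′ : comparisonOf (action q b) ≡ sameParity
    cmp′ = trans (cong (comparisonOf ∘ proj₁) eq′) cmp
    moves : action q b ≢ stop
    moves st with () ← trans (sym cmp′) (cong comparisonOf st)

  run-exec : ∀ q {a s h σ σ′} → progℕ q ≡ exec a s → comparisonOf (mapAction clamp a) ≡ sameParity →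
             Effect a σ σ′ → Run (q ∷ h ∣ ⌊ σ ⌋) (s ∷ q ∷ h ∣ ⌊ σ′ ⌋)
  run-exec q {a} eq = run-rule q false {a} (cong (λ i → rule i false) eq)

  run-zero : ∀ q {r s₀ s₁ h σ} → progℕ q ≡ jump r s₀ s₁ → σ r ≡ 0 → Run (q ∷ h ∣ ⌊ σ ⌋) (s₀ ∷ q ∷ h ∣ ⌊ σ ⌋)
  run-zero q {r} {σ = σ} eq z = run-rule q false {test r false} {σ = σ} {σ} (cong (λ i → rule i false) eq) refl
    (cong (0 <ᵇ_) z , λ _ → refl)

  run-suc : ∀ q {r s₀ s₁ h σ n} → progℕ q ≡ jump r s₀ s₁ → σ r ≡ suc n → Run (q ∷ h ∣ ⌊ σ ⌋) (s₁ ∷ q ∷ h ∣ ⌊ σ ⌋)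
  run-suc q {r} {σ = σ} eq z = run-rule q true {test r true} {σ = σ} {σ} (cong (λ i → rule i true) eq) refl
    (cong (0 <ᵇ_) z , λ _ → refl)

  -- Induction on the execution; `link` says that the program contains the code of c at the states
  -- given by `emb`.
  exec-run : ∀ {c σ σ′} → Exec c σ σ′ → (emb : Pos c → S) (exit : S) →
             (∀ p → progℕ (emb p) ≡ code c emb exit p) →
             ∀ h → ∃ λ h′ → Run (emb (entry c) ∷ h ∣ ⌊ σ ⌋) (exit ∷ h′ ∣ ⌊ σ′ ⌋)
  exec-run {add1 r} {σ} add1 emb exit link h =
    _ , run-exec (emb tt) (link tt) refl (↦-same σ r _ , λ x → ↦-other σ r _)
  exec-run {sub1 r} {σ} (sub1 eq) emb exit link h =
    _ , run-exec (emb tt) (link tt) refl (trans eq (cong suc (sym (↦-same σ r _))) , λ x → ↦-other σ r _)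
  exec-run {dup a b} {σ} (dup eq) emb exit link h =
    _ , run-exec (emb tt) (link tt) refl (eq , ↦-same σ b _ , λ x → ↦-other σ b _)
  exec-run {c ⨾ c′} (ex ⨾ ex′) emb exit link h
    with exec-run ex (emb ∘ inj₁) (emb (inj₂ (entry c′))) (link ∘ inj₁) h
  ... | h₁ , run₁ with exec-run ex′ (emb ∘ inj₂) exit (link ∘ inj₂) h₁
  ... | h₂ , run₂ = h₂ , run₁ ∙ run₂
  exec-run {while r c} (while0 eq) emb exit link h = _ , run-zero (emb (inj₁ tt)) (link (inj₁ tt)) eq
  exec-run {while r c} (whileS eq ex ex′) emb exit link h
    with exec-run ex (emb ∘ inj₂) (emb (inj₁ tt)) (link ∘ inj₂) (emb (inj₁ tt) ∷ h)
  ... | h₁ , run₁ with exec-run ex′ emb exit link h₁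
  ... | h₂ , run₂ = h₂ , run-suc (emb (inj₁ tt)) (link (inj₁ tt)) eq ∙ (run₁ ∙ run₂)

-- The machine that descends along the relation.

module Descent (c : PR 2) where

  -- Register 0 holds the current point, 1 the padding, 2 the guessed point, 3 the value of c.
  abstract
    check reset : Cmd
    check = compile c (2 ∷ 0 ∷ []) 3 4
    reset = set 2 0 ⨾ clear 2 ⨾ clear 1

    reset-computes : ∀ σ → ∃ λ σ′ → Exec reset σ σ′ × σ′ 0 ≡ σ 2 × σ′ 1 ≡ 0 × σ′ 2 ≡ 0
    reset-computes σ with set-assigns 2 0 σ (λ ())
    ... | σ₁ , ex₁ , eq₁ , same₁ with clear-assigns (σ₁ 2) 2 σ₁ refl
    ... | σ₂ , ex₂ , eq₂ , same₂ with clear-assigns (σ₂ 1) 1 σ₂ refl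
    ... | σ₃ , ex₃ , eq₃ , same₃ = σ₃ , (ex₁ ⨾ ex₂ ⨾ ex₃) ,
      trans (same₃ 0 (λ ())) (trans (same₂ 0 (λ ())) eq₁) , eq₃ , trans (same₃ 2 (λ ())) eq₂

    check-computes : ∀ {i n v} → Eval c (i ∷ n ∷ []) v → ∀ σ → σ 0 ≡ n → σ 2 ≡ i → Computes check 3 4 v σ
    check-computes {i} {n} ev σ eq₀ eq₂ = compile-computes ev (2 ∷ 0 ∷ []) 3 4 σ inputs distinct ≤-refl
      where
      inputs : Inputs (2 ∷ 0 ∷ []) (i ∷ n ∷ []) 4 σ
      inputs zero       = s≤s (s≤s (s≤s z≤n)) , eq₂
      inputs (suc zero) = s≤s z≤n , eq₀
      distinct : ∀ j → lookup (2 ∷ 0 ∷ []) j ≢ 3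
      distinct zero       ()
      distinct (suc zero) ()

  Label : Set
  Label = Fin 6 ⊎ (Pos check ⊎ Pos reset)

  abstract
    finite-Label : Finite Label
    finite-Label = finite-⊎ (finite-Fin 6) (finite-⊎ (finite-Pos check) (finite-Pos reset))

  pattern guessPad   = inj₁ zero
  pattern guessPoint = inj₁ (suc zero)
  pattern testValue  = inj₁ (suc (suc zero))
  pattern decrement  = inj₁ (suc (suc (suc zero)))
  pattern testOne    = inj₁ (suc (suc (suc (suc zero))))
  pattern reject     = inj₁ (suc (suc (suc (suc (suc zero)))))

  checking : Pos check → Label
  checking p = inj₂ (inj₁ p)

  resetting : Pos reset → Label
  resetting p = inj₂ (inj₂ p)

  -- The value 1 is recognised as a positive number that one decrement takes to 0; all other values
  -- are rejected. After acceptance, `reset` makes the guessed point the current one and empties the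
  -- registers of both guesses.
  program : Label → Instr Label ℕ
  program guessPad        = exec (guess 1) guessPoint
  program guessPoint      = exec (guess 2) (checking (entry check))
  program (inj₂ (inj₁ p)) = code check checking testValue p
  program testValue       = jump 3 reject decrement
  program decrement       = exec (dec 3) testOne
  program testOne         = jump 3 (resetting (entry reset)) reject
  program (inj₂ (inj₂ p)) = code reset resetting guessPad p
  program reject          = exec stop reject

  open Assembled finite-Label program public

  -- Registers 1 and 2 must be empty for the coming guesses; those from 3 on may hold remnants of
  -- earlier rounds.
  data At (n : ℕ) : Config → Set where
    ready : ∀ {h σ} → σ 0 ≡ n → σ 1 ≡ 0 → σ 2 ≡ 0 → At n (guessPad ∷ h ∣ ⌊ σ ⌋)

  check-run : ∀ {i n v} → Eval c (i ∷ n ∷ []) v → ∀ h σ → σ 0 ≡ n → σ 2 ≡ i →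
              ∃ λ h′ → ∃ λ σ′ → Run (checking (entry check) ∷ h ∣ ⌊ σ ⌋) (testValue ∷ h′ ∣ ⌊ σ′ ⌋) ×
                                σ′ 3 ≡ v × σ′ 2 ≡ i
  check-run ev h σ eq₀ eq₂ with check-computes ev σ eq₀ eq₂
  ... | σ′ , ex , eq₃ , same with exec-run ex checking testValue (λ _ → refl) h
  ... | h′ , run = h′ , σ′ , run , eq₃ , trans (same 2 (s≤s (s≤s (s≤s z≤n))) (λ ())) eq₂

  accept-run : ∀ {i} h σ → σ 3 ≡ 1 → σ 2 ≡ i → ∃ λ d → Run (testValue ∷ h ∣ ⌊ σ ⌋) d × At i d
  accept-run h σ eq₃ eq₂ with reset-computes (σ [ 3 ↦ 0 ])
  ... | σ′ , ex , e₀ , e₁ , e₂ with exec-run ex resetting guessPad (λ _ → refl) (testOne ∷ decrement ∷ testValue ∷ h)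
  ... | h′ , run = (guessPad ∷ h′ ∣ ⌊ σ′ ⌋) ,
    (run-suc testValue {σ = σ} refl eq₃ ∙
      (run-exec decrement {σ = σ} {σ [ 3 ↦ 0 ]} refl refl
        (trans eq₃ (cong suc (sym (↦-same σ 3 0))) , λ x → ↦-other σ 3 0) ∙
      (run-zero testOne {σ = σ [ 3 ↦ 0 ]} refl (↦-same σ 3 0) ∙ run))) ,
    ready {h = h′} {σ′} (trans e₀ (trans (↦-other σ 3 0 (λ ())) eq₂)) e₁ e₂

  safe-reject : ∀ {h σ} → Safe (reject ∷ h ∣ σ)
  safe-reject = safe-stop refl

  -- Values other than 1 lead to `reject`, which is safe; only for 1 does the machine go on.
  safe-value : ∀ v h σ → σ 3 ≡ v → (v ≡ 1 → Safe (testValue ∷ h ∣ ⌊ σ ⌋)) → Safe (testValue ∷ h ∣ ⌊ σ ⌋)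
  safe-value zero h σ eq one = proj₂ (run-zero testValue {σ = σ} refl eq) safe-reject
  safe-value (suc zero) h σ eq one = one refl
  safe-value (suc (suc v)) h σ eq one = proj₂
    (run-suc testValue {σ = σ} refl eq ∙
      (run-exec decrement {σ = σ} {σ [ 3 ↦ suc v ]} refl refl
        (trans eq (cong suc (sym (↦-same σ 3 (suc v)))) , λ x → ↦-other σ 3 (suc v)) ∙
      run-suc testOne {σ = σ [ 3 ↦ suc v ]} refl (↦-same σ 3 (suc v)))) safe-reject

  guess-effect : ∀ r {σ} → r < M → σ r ≡ 0 → ∀ y → Effect (guess (clamp r)) ⌊ σ ⌋ ⌊ σ [ r ↦ y ] ⌋
  guess-effect r {σ} lt eq y = effect-clamp (guess r) {σ} {σ [ r ↦ y ]} lt (eq , λ x → ↦-other σ r y)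

  guess-value : ∀ r σ → r < M → ∀ y → ⌊ σ [ r ↦ y ] ⌋ (clamp r) ≡ y
  guess-value r σ lt y = trans (cong (σ [ r ↦ y ]) (toℕ-clamp lt)) (↦-same σ r y)

  1<M : 1 < M
  1<M = fits guessPad false

  2<M : 2 < M
  2<M = fits guessPoint false

  -- Well-founded induction on n. By totality the check halts for every guess i, and it accepts only
  -- if i is related to n, so that the induction hypothesis applies to i.
  at-safe : Total2 c → ∀ {n} → Acc (RelOf c) n → ∀ {d} → At n d → Safe d
  at-safe total {n} (acc rs) (ready {h} {σ} eq₀ eq₁ eq₂) =
    safe-guess refl λ t → ⌊ σ [ 1 ↦ t ] ⌋ , guess-value 1 σ 1<M t , guess-effect 1 {σ} 1<M eq₁ t ,
    safe-guess refl λ i → ⌊ σ [ 1 ↦ t ] [ 2 ↦ i ] ⌋ , guess-value 2 (σ [ 1 ↦ t ]) 2<M i ,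
      guess-effect 2 {σ [ 1 ↦ t ]} 2<M eq₂ i , checked t i
    where
    checked : ∀ t i → Safe (checking (entry check) ∷ guessPoint ∷ guessPad ∷ h ∣ ⌊ σ [ 1 ↦ t ] [ 2 ↦ i ] ⌋)
    checked t i with total i n
    ... | v , ev with check-run ev (guessPoint ∷ guessPad ∷ h) (σ [ 1 ↦ t ] [ 2 ↦ i ]) eq₀ refl
    ... | h′ , σ′ , run , e₃ , e₂ = proj₂ run (safe-value v h′ σ′ e₃ one)
      where
      one : v ≡ 1 → Safe (testValue ∷ h′ ∣ ⌊ σ′ ⌋)
      one refl with accept-run h′ σ′ e₃ e₂
      ... | d , run′ , at′ = proj₂ run′ (at-safe total (rs ev) at′)

  -- The padding is guessed before the point, so already the first configuration after the present
  -- one holds t.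
  descend : ∀ {j n d} → At n d → RelOf c j n → ∀ t →
            ∃ λ d′ → ∃ λ e → Step d d′ × t ≤ registers d′ (clamp 1) × Path d′ e × At j e
  descend {j} (ready {h} {σ} eq₀ eq₁ eq₂) ev t
    with check-run ev (guessPoint ∷ guessPad ∷ h) (σ [ 1 ↦ t ] [ 2 ↦ j ]) eq₀ refl
  ... | h′ , σ′ , run , e₃ , e₂ with accept-run h′ σ′ e₃ e₂
  ... | e , run′ , at′ = (guessPoint ∷ guessPad ∷ h ∣ ⌊ σ [ 1 ↦ t ] ⌋) , e ,
    step false (λ ()) (guess-effect 1 {σ} 1<M eq₁ t) ,
    ℕₚ.≤-reflexive (sym (guess-value 1 σ 1<M t)) ,
    (step false (λ ()) (guess-effect 2 {σ [ 1 ↦ t ]} 2<M eq₂ j) ◅ proj₁ (run ∙ run′)) , at′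

  initial : ℕ → Store
  initial n zero    = n
  initial n (suc _) = 0

theorem3 : (c : PR 2) → Total2 c → (wf : WellFounded (RelOf c)) →
    Σ AutoStruct λ A → ScottRankAtLeastHeight A (RelOf c) wf
theorem3 c total wf = structure ,
  scottRank (RelOf c) wf (clamp 1) At guessPad (λ n → ⌊ initial n ⌋)
    start (λ n → at-safe total (wf n) (start n)) descend
  where
  open Descent c
  start : ∀ n → At n (guessPad ∷ [] ∣ ⌊ initial n ⌋)
  start n = ready {h = []} {initial n} refl refl refl
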